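{- Directed comparison. For directed metric instances (with the notation of the context): 1. $w(\mathsf{AF}_d)\le w(\mathsf{ARCS}_d)$ for all $d\ge 1$ and all directed instances, and this is tight. 2. $w(\mathsf{ATSP})\le w(\mathsf{ARCS}_d)$ for all $d\ge 1$ and all directed instances, and this is tight. 3. $w(\mathsf{AF}_{d-1})\le \frac{d-1}{d}\cdot w(\mathsf{AF}_d)$ and $w(\mathsf{ARCS}_{d-1})\le w(\mathsf{ARCS}_d)$ for all $d\ge 2$ and all directed instances, and both inequalities are tight.
   Context: A directed instance is a complete directed graph $G=(V,E)$ (all arcs $(x,y)$ with $x\ne y$) on $n$ vertices with non-negative arc weights $w$ satisfying the triangle inequality $w(x,z)\le w(x,y)+w(y,z)$; $w$ need not be symmetric. A directed $d$-factor is a spanning subgraph in which every vertex has indegree $d$ and outdegree $d$; only instances with $d\le n-1$ are considered. The weight of a subgraph is the sum of its arc weights. For a given instance: $\mathsf{ATSP}$ is a minimum-weight directed Hamiltonian cycle; $\mathsf{AF}_d$ is a minimum-weight directed $d$-factor (not necessarily connected); $\mathsf{ARCS}_d$ is a minimum-weight connected directed $d$-factor (since indegree equals outdegree at every vertex, weak and strong connectivity coincide). An inequality $A\le c\cdot B$ is called tight if, for every $\varepsilon>0$, replacing $c$ by $c-\varepsilon$ does not yield a valid statement for all instances. -}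

module Defs where

open import Algebra.Bundles using (CommutativeRing)
import Algebra.Definitions.RawMonoid as RawMonoidOperations
open import Data.Bool.Base using (Bool; true; false; T; if_then_else_)
open import Data.Fin.Base using (Fin; toℕ)
open import Data.Fin.Permutation using (Permutation′; _⟨$⟩ʳ_)
open import Data.Fin.Subset using (∣_∣)
open import Data.Nat.Base as ℕ using (ℕ; zero; suc)
open import Data.Nat.DivMod using (_mod_)
open import Data.Product.Base using (∃; _×_)
open import Data.Vec.Base using (tabulate)
open import Function.Bundles using (_⇔_)
open import Level using (Level; _⊔_) renaming (suc to lsuc)
open import Relation.Binary.Construct.Closure.Equivalence using (EqClosure)
open import Relation.Binary.Core using (Rel)
open import Relation.Binary.PropositionalEquality.Core using (_≡_; _≢_)
open import Relation.Binary.Structures using (IsTotalOrder)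
open import Relation.Nullary.Negation.Core using (¬_)

-- Weights live in an arbitrary totally ordered field, e.g. the rationals or
-- the (classical) reals.  The inverse is a total operation whose value at 0#
-- is unconstrained.
record OrderedField (a ℓ₁ ℓ₂ : Level) : Set (lsuc (a ⊔ ℓ₁ ⊔ ℓ₂)) where
  infix  4 _≤_ _<_
  infix  8 _⁻¹
  infixl 7 _/_
  field
    commutativeRing : CommutativeRing a ℓ₁

  open CommutativeRing commutativeRing public

  field
    _≤_          : Rel Carrier ℓ₂
    _⁻¹          : Carrier → Carrier
    isTotalOrder : IsTotalOrder _≈_ _≤_
    +-monoˡ-≤    : ∀ z {x y} → x ≤ y → x + z ≤ y + z
    *-nonNeg     : ∀ {x y} → 0# ≤ x → 0# ≤ y → 0# ≤ x * y
    0≉1          : ¬ (0# ≈ 1#)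
    ⁻¹-cong      : ∀ {x y} → x ≈ y → x ⁻¹ ≈ y ⁻¹
    *-inverseʳ   : ∀ {x} → ¬ (x ≈ 0#) → x * x ⁻¹ ≈ 1#

  _<_ : Rel Carrier (ℓ₁ ⊔ ℓ₂)
  x < y = x ≤ y × ¬ (x ≈ y)

  _/_ : Carrier → Carrier → Carrier
  x / y = x * y ⁻¹

  open RawMonoidOperations +-rawMonoid using (sum) public

  fromℕ : ℕ → Carrier
  fromℕ n = RawMonoidOperations._×_ +-rawMonoid n 1#

-- Spanning subgraphs of the complete directed graph on Fin n.
record Subgraph (n : ℕ) : Set where
  field
    arc      : Fin n → Fin n → Bool
    loopless : ∀ x → arc x x ≡ false

  Arc : Fin n → Fin n → Set
  Arc x y = T (arc x y)

  outdegree : Fin n → ℕ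
  outdegree x = ∣ tabulate (λ y → arc x y) ∣

  indegree : Fin n → ℕ
  indegree y = ∣ tabulate (λ x → arc x y) ∣

open Subgraph

SubgraphProperty : Set₁
SubgraphProperty = ∀ {n} → Subgraph n → Set

-- Weak connectivity: arcs may be traversed in either direction.
Connected : SubgraphProperty
Connected F = ∀ x y → EqClosure (Arc F) x y

Factor : ℕ → SubgraphProperty
Factor d F = ∀ x → indegree F x ≡ d × outdegree F x ≡ d

ConnectedFactor : ℕ → SubgraphProperty
ConnectedFactor d F = Factor d F × Connected F

next : ∀ {n} → Fin n → Fin n
next {suc m} i = suc (toℕ i) mod suc m

-- The permutation π lists the vertices in the order in which the cycle
-- visits them.
HamiltonianCycle : SubgraphProperty
HamiltonianCycle {n} H =
  ∃ λ (π : Permutation′ n) → ∀ x y →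
    Arc H x y ⇔ (∃ λ i → π ⟨$⟩ʳ i ≡ x × π ⟨$⟩ʳ next i ≡ y)

module Comparison {a ℓ₁ ℓ₂ : Level} (K : OrderedField a ℓ₁ ℓ₂) where

  open OrderedField K

  -- Only the values of w off the diagonal are constrained or ever used.
  record Instance (n : ℕ) : Set (a ⊔ ℓ₂) where
    field
      w        : Fin n → Fin n → Carrier
      nonNeg   : ∀ {x y} → x ≢ y → 0# ≤ w x y
      triangle : ∀ {x y z} → x ≢ y → y ≢ z → x ≢ z → w x z ≤ w x y + w y z

  weight : ∀ {n} → Instance n → Subgraph n → Carrier
  weight G F =
    sum λ x → sum λ y → if arc F x y then Instance.w G x y else 0#

  MinimumWeight : SubgraphProperty → ∀ {n} → Instance n → Subgraph n → Set ℓ₂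
  MinimumWeight P G F =
    P F × (∀ F′ → P F′ → weight G F ≤ weight G F′)

  -- w(A) ≤ c · w(B) on every instance with d ≤ n - 1, where A and B are
  -- minimum-weight subgraphs with the properties P and Q respectively.
  Valid : ℕ → SubgraphProperty → Carrier → SubgraphProperty → Set (a ⊔ ℓ₂)
  Valid d P c Q =
    ∀ {n} → d ℕ.< n → (G : Instance n) (A B : Subgraph n) →
    MinimumWeight P G A → MinimumWeight Q G B →
    weight G A ≤ c * weight G B

  Tight : ℕ → SubgraphProperty → Carrier → SubgraphProperty → Set (a ⊔ ℓ₁ ⊔ ℓ₂)
  Tight d P c Q = ∀ ε → 0# < ε → ¬ Valid d P (c - ε) Q

  ValidAndTight : ℕ → SubgraphProperty → Carrier → SubgraphProperty →
                  Set (a ⊔ ℓ₁ ⊔ ℓ₂)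
  ValidAndTight d P c Q = Valid d P c Q × Tight d P c Q

{-# OPTIONS --safe #-}
module Submission where

open import Defs
open import Algebra.Bundles using (CommutativeMonoid)
import Algebra.Properties.Ring as RingProperties
open import Data.Bool.Base using (Bool; true; false; T; not; _∧_; _∨_; if_then_else_)
open import Data.Bool.Properties using (T-∧; T-∨; T?; T-≡)
open import Data.Fin.Base using (Fin; zero; suc; toℕ; fromℕ<; _↑ˡ_; _↑ʳ_; splitAt)
open import Data.Fin.Permutation as Perm using (Permutation′; _⟨$⟩ʳ_; _⟨$⟩ˡ_; _∘ₚ_; transpose)
import Data.Fin.Permutation.Components as PC
open import Data.Fin.Properties using
  ( _≟_; any?; toℕ<n; toℕ-fromℕ<; toℕ-injective; pigeonhole; injective⇒≤; <-cmp
  ; splitAt-↑ˡ; splitAt-↑ʳ)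
open import Data.Fin.Subset using (Subset; _∈_; _∪_; ⁅_⁆; _⊃_; _⊂_; ∣_∣)
open import Data.Fin.Subset.Induction using (Acc; acc; ⊃-wellFounded; ⊂-wellFounded)
open import Data.Fin.Subset.Properties using (_∈?_; x∈⁅x⁆; x∈⁅y⁆⇒x≡y; x∈p∪q⁻; p⊆p∪q; q⊆p∪q)
open import Data.Nat.Base as ℕ using (ℕ; zero; suc; _∸_; z≤n; s≤s)
open import Data.Nat.DivMod using
  (_mod_; _%_; %-distribˡ-+; m%n%n≡m%n; [m+n]%n≡m%n; m<n⇒m%n≡m; n%n≡0; m%n<n)
import Data.Nat.Properties as ℕ
open import Data.Product.Base using (∃; _×_; _,_; proj₁; proj₂)
open import Data.Sum.Base using (_⊎_; inj₁; inj₂; [_,_]; [_,_]′)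
open import Data.Unit.Base using (tt)
open import Data.Vec.Base using (tabulate)
open import Data.Vec.Properties using (lookup∘tabulate; []=⇒lookup; lookup⇒[]=)
open import Function.Base using (_∘_; id; flip; const)
open import Function.Bundles using (Equivalence; Injection; mk⇔)
open import Function.Properties.Inverse using (↔⇒↣)
open import Level using (0ℓ; _⊔_)
open import Relation.Binary.Bundles using (Poset)
open import Relation.Binary.Construct.Closure.Equivalence as EqC using (EqClosure)
open import Relation.Binary.Construct.Closure.ReflexiveTransitive using (Star; ε; _◅_; _◅◅_)
open import Relation.Binary.Construct.Closure.Symmetric using (SymClosure; fwd; bwd)
open import Relation.Binary.Core using (Rel)
open import Relation.Binary.Definitions using (Decidable; tri<; tri≈; tri>)
open import Relation.Binary.PropositionalEquality
  using (_≡_; _≢_; refl; sym; trans; cong; cong₂; subst; subst₂; module ≡-Reasoning)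
import Relation.Binary.Reasoning.PartialOrder as PosetReasoning
open import Relation.Binary.Structures using (IsTotalOrder)
open import Relation.Nullary using (Dec; does; yes; no; ¬_; contradiction)
open import Relation.Nullary.Decidable using (_×-dec_; _⊎-dec_; ¬?; dec-true; dec-false; does-⇔; map′)
import Relation.Unary as U

-- By König's theorem a d-factor B is a union of d permutations.  Deleting any
-- one of them, σ, leaves a (d-1)-factor, so w(AF_{d-1}) ≤ w(B) - w(σ); summing
-- over the d choices gives the factor (d-1)/d.  For connected factors the
-- pieces left after the deletion of σ are rejoined along σ itself at total cost
-- at most w(σ): σ is first shortcut until some orbit x₁ → ⋯ → x_k → x₁ visits
-- k distinct components, and then an arc a_i → x_i of each of these is replaced
-- by a_i → x_{i+1}, which costs at most w(x_i, x_{i+1}).  Iterating this down to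
-- degree 1 yields a Hamiltonian cycle, hence w(ATSP) ≤ w(ARCS_d).
--
-- Tightness: if only the arcs leaving one vertex have weight 1, and all others
-- weight 0, then every d-factor weighs exactly d.  If only the arcs from one
-- (d+1)-clique to another one have weight 1, then two disjoint cliques can be
-- joined at cost 1, whereas every connected factor and every Hamiltonian cycle
-- weighs at least 1.

open Subgraph

private variable
  n e : ℕ

-- Regular Boolean matrices

Matrix : ℕ → Set
Matrix n = Fin n → Fin n → Bool

χ : Bool → ℕ
χ b = if b then 1 else 0

-- `f` is the disjoint union of `g` and the graph of `σ`: every `χ` is 0 or 1, so one equation in ℕ
-- expresses the union and the disjointness together.
record Splits (f g : Matrix n) (σ : Permutation′ n) : Set where
  constructor mkSplits
  field
    split : ∀ u v → χ (f u v) ≡ χ (g u v) ℕ.+ χ (does (σ ⟨$⟩ʳ u ≟ v))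

open Splits

-- Generic in the monoid because `sum-splits` serves twice: over ℕ it counts degrees, over the
-- additive monoid of the field it splits weights.
module MatrixSums {c ℓ} (M : CommutativeMonoid c ℓ) where
  open CommutativeMonoid M renaming (refl to ≈-refl; sym to ≈-sym; trans to ≈-trans; ε to 0#)
  open import Algebra.Properties.CommutativeMonoid.Sum M public

  sum-zero : {f : Fin n → Carrier} → (∀ i → f i ≈ 0#) → sum f ≈ 0#
  sum-zero {n} f≈0# = ≈-trans (sum-cong-≋ f≈0#) (sum-replicate-zero n)

  sum-δ : ∀ (i : Fin n) (g : Fin n → Carrier) →
          sum (λ j → if does (i ≟ j) then g j else 0#) ≈ g i
  sum-δ {suc n} zero    g = ≈-trans (∙-congˡ (sum-replicate-zero n)) (identityʳ _)
  sum-δ {suc n} (suc i) g = ≈-trans (identityˡ _) (sum-δ i (g ∘ suc))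

  if-split : ∀ a b c → χ a ≡ χ b ℕ.+ χ c → (x : Carrier) →
             (if a then x else 0#) ≈ (if b then x else 0#) ∙ (if c then x else 0#)
  if-split true  true  true  () x
  if-split true  true  false _  x = ≈-sym (identityʳ _)
  if-split true  false true  _  x = ≈-sym (identityˡ _)
  if-split true  false false () x
  if-split false true  true  () x
  if-split false true  false () x
  if-split false false true  () x
  if-split false false false _  x = ≈-sym (identityʳ _)

  sum-splits : ∀ {f g : Matrix n} {σ} → Splits f g σ → ∀ u (h : Fin n → Carrier) →
               sum (λ v → if f u v then h v else 0#) ≈
               sum (λ v → if g u v then h v else 0#) ∙ h (σ ⟨$⟩ʳ u)
  sum-splits {f = f} {g} {σ} s u h =
    ≈-trans (sum-cong-≋ (λ v → if-split (f u v) (g u v) (does (σ ⟨$⟩ʳ u ≟ v)) (split s u v) (h v)))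
    (≈-trans (∑-distrib-+ (λ v → if g u v then h v else 0#) _)
    (∙-congˡ (sum-δ (σ ⟨$⟩ʳ u) h)))

private module ℕ∑ = MatrixSums ℕ.+-0-commutativeMonoid

OutRegular : ℕ → Matrix n → Set
OutRegular e f = ∀ u → ℕ∑.sum (λ v → χ (f u v)) ≡ e

Regular : ℕ → Matrix n → Set
Regular e f = OutRegular e f × OutRegular e (flip f)

-- Transposing a matrix inverts the permutation, so statements on columns become row statements for
-- the flipped splitting.
splits-flip : ∀ {f g : Matrix n} {σ} → Splits f g σ → Splits (flip f) (flip g) (Perm.flip σ)
splits-flip {g = g} {σ} s = mkSplits λ v u → trans (split s u v) (cong (λ b → χ (g u v) ℕ.+ χ b)
  (does-⇔ (mk⇔ (λ { refl → Perm.inverseˡ σ }) (λ { refl → Perm.inverseʳ σ }))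
          (σ ⟨$⟩ʳ u ≟ v) (σ ⟨$⟩ˡ v ≟ u)))

splits-out : ∀ {f g : Matrix n} {σ} → Splits f g σ →
             ∀ u → ℕ∑.sum (λ v → χ (f u v)) ≡ suc (ℕ∑.sum (λ v → χ (g u v)))
splits-out s u = trans (ℕ∑.sum-splits s u (λ _ → 1)) (ℕ.+-comm _ 1)

regular-delete : ∀ {f g : Matrix n} {σ} → Splits f g σ → Regular (suc e) f → Regular e g
regular-delete s (r , c) =
  (λ u → ℕ.suc-injective (trans (sym (splits-out s u)) (r u))) ,
  (λ v → ℕ.suc-injective (trans (sym (splits-out (splits-flip s) v)) (c v)))

regular-insert : ∀ {f g : Matrix n} {σ} → Splits f g σ → Regular e g → Regular (suc e) f
regular-insert s (r , c) =
  (λ u → trans (splits-out s u) (cong suc (r u))) ,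
  (λ v → trans (splits-out (splits-flip s) v) (cong suc (c v)))

opaque
  delete insert : Matrix n → Permutation′ n → Matrix n
  delete f σ u v = f u v ∧ not (does (σ ⟨$⟩ʳ u ≟ v))
  insert g σ u v = g u v ∨ does (σ ⟨$⟩ʳ u ≟ v)

  splits-delete : ∀ (f : Matrix n) σ → (∀ u → T (f u (σ ⟨$⟩ʳ u))) → Splits f (delete f σ) σ
  splits-delete f σ σ⊆f .split u v with σ ⟨$⟩ʳ u ≟ v | f u v in eq
  ... | yes _    | true  = refl
  ... | yes refl | false = contradiction (subst T eq (σ⊆f u)) λ ()
  ... | no _     | true  = refl
  ... | no _     | false = refl

  splits-insert : ∀ (g : Matrix n) σ → (∀ u → ¬ T (g u (σ ⟨$⟩ʳ u))) → Splits (insert g σ) g σ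
  splits-insert g σ σ∩g .split u v with σ ⟨$⟩ʳ u ≟ v | g u v in eq
  ... | yes refl | true  = contradiction (subst T (sym eq) tt) (σ∩g u)
  ... | yes _    | false = refl
  ... | no _     | true  = refl
  ... | no _     | false = refl

  insert-⊇ : ∀ (g : Matrix n) τ {u v} → T (g u v) → T (insert g τ u v)
  insert-⊇ g τ uv = Equivalence.from T-∨ (inj₁ uv)

  insert-∋ : ∀ (g : Matrix n) τ {u v} → τ ⟨$⟩ʳ u ≡ v → T (insert g τ u v)
  insert-∋ g τ {u} {v} τu≡v = Equivalence.from (T-∨ {g u v}) (inj₂ (Equivalence.from T-≡ (dec-true (τ ⟨$⟩ʳ u ≟ v) τu≡v)))

  insert-cases : ∀ (g : Matrix n) τ {u v} → T (insert g τ u v) → T (g u v) ⊎ τ ⟨$⟩ʳ u ≡ v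
  insert-cases g τ {u} {v} uv with τ ⟨$⟩ʳ u ≟ v | Equivalence.to (T-∨ {g u v}) uv
  ... | yes τu≡v | _       = inj₂ τu≡v
  ... | no _     | inj₁ g∋ = inj₁ g∋

  delete-⊆ : ∀ (f : Matrix n) σ {u v} → T (delete f σ u v) → T (f u v)
  delete-⊆ f σ = proj₁ ∘ Equivalence.to T-∧

  delete-∌ : ∀ (f : Matrix n) σ {u} → ¬ T (delete f σ u (σ ⟨$⟩ʳ u))
  delete-∌ f σ {u} uv with f u (σ ⟨$⟩ʳ u)
  ... | true rewrite dec-true (σ ⟨$⟩ʳ u ≟ σ ⟨$⟩ʳ u) refl = uv

  delete-∋ : ∀ (f : Matrix n) σ {u v} → T (f u v) → σ ⟨$⟩ʳ u ≢ v → T (delete f σ u v)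
  delete-∋ f σ {u} {v} uv σu≢v rewrite dec-false (σ ⟨$⟩ʳ u ≟ v) σu≢v = Equivalence.from T-∧ (uv , tt)

sum-mono-≤ : {a b : Fin n → ℕ} → (∀ i → a i ℕ.≤ b i) → ℕ∑.sum a ℕ.≤ ℕ∑.sum b
sum-mono-≤ {zero}  le = z≤n
sum-mono-≤ {suc n} le = ℕ.+-mono-≤ (le zero) (sum-mono-≤ (le ∘ suc))

-- Heads and tails can each differ in one direction only, so equal totals leave no room for either.
-- Through this lemma counting arguments rule out single arcs.
sum-≡⇒≗ : {a b : Fin n → ℕ} → (∀ i → a i ℕ.≤ b i) → ℕ∑.sum a ≡ ℕ∑.sum b → ∀ i → a i ≡ b i
sum-≡⇒≗ {suc n} {a} {b} le eq = λ { zero → head≡ ; (suc i) → sum-≡⇒≗ (le ∘ suc) tail≡ i }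
  where
  head≡ : a zero ≡ b zero
  head≡ = ℕ.≤-antisym (le zero) (ℕ.+-cancelʳ-≤ (ℕ∑.sum (a ∘ suc)) _ _
    (ℕ.≤-trans (ℕ.+-monoʳ-≤ (b zero) (sum-mono-≤ (le ∘ suc))) (ℕ.≤-reflexive (sym eq))))
  tail≡ : ℕ∑.sum (a ∘ suc) ≡ ℕ∑.sum (b ∘ suc)
  tail≡ = ℕ.+-cancelˡ-≡ (a zero) _ _ (trans eq (cong (ℕ._+ ℕ∑.sum (b ∘ suc)) (sym head≡)))

sum-witness : (p : Fin n → Bool) → ℕ∑.sum (χ ∘ p) ≡ suc e → ∃ λ i → T (p i)
sum-witness {suc n} p eq with p zero in p₀
... | true  = zero , subst T (sym p₀) tt
... | false = let i , pᵢ = sum-witness (p ∘ suc) eq in suc i , pᵢ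

-- A set closed under outgoing arcs has as many incoming arcs as outgoing
-- arcs, hence no arc enters it from outside.
closed-backwards : ∀ {p} {f : Matrix n} {P : U.Pred (Fin n) p} → Regular e f → U.Decidable P →
                   (∀ {u v} → T (f u v) → P u → P v) →
                   ∀ {u v} → T (f u v) → P v → P u
closed-backwards {n} {e} {f = f} {P} (r , c) P? closed {u} {v} uv Pv with P? u in eq
... | yes Pu = Pu
... | no ¬Pu = contradiction tight (subst₂ (λ b b′ → χ (b ∧ f u v) ≢ χ (b′ ∧ f u v))
                 (sym (cong does eq)) (sym (dec-true (P? v) Pv))
                 (λ 0≡ → contradiction (subst (λ b → 0 ≡ χ b) (Equivalence.to T-≡ uv) 0≡) λ ()))
  where
  out in′ : Fin n → Fin n → ℕ
  out u v = χ (does (P? u) ∧ f u v)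
  in′ u v = χ (does (P? v) ∧ f u v)

  out≤in : ∀ u v → out u v ℕ.≤ in′ u v
  out≤in u v with P? u | P? v | f u v in eq
  ... | no _   | _      | _     = z≤n
  ... | yes _  | yes _  | _     = ℕ.≤-refl
  ... | yes _  | no _   | false = z≤n
  ... | yes Pu | no ¬Pv | true  = contradiction (closed (subst T (sym eq) tt) Pu) ¬Pv

  sum-∧ : ∀ b (g : Fin n → Bool) → ℕ∑.sum (χ ∘ g) ≡ e → ℕ∑.sum (λ i → χ (b ∧ g i)) ≡ (if b then e else 0)
  sum-∧ true  g eq = eq
  sum-∧ false g eq = ℕ∑.sum-replicate-zero n

  total : ℕ∑.sum (λ u → ℕ∑.sum (out u)) ≡ ℕ∑.sum (λ u → ℕ∑.sum (in′ u))
  -- Summed by rows, `out` counts the `e` arcs leaving each member of `P`; summed by columns, `in′`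
  -- counts the `e` arcs entering each.
  total = trans
    (trans (ℕ∑.sum-cong-≗ (λ u → sum-∧ (does (P? u)) (f u) (r u)))
           (ℕ∑.sum-cong-≗ (λ v → sym (sum-∧ (does (P? v)) (flip f v) (c v)))))
    (ℕ∑.∑-comm (λ v u → in′ u v))

  tight : out u v ≡ in′ u v
  tight = sum-≡⇒≗ (out≤in u) (sum-≡⇒≗ (sum-mono-≤ ∘ out≤in) total u) v

-- Decidability of reachability in finite digraphs

module Reachability {ℓ} {R : Rel (Fin n) ℓ} (R? : Decidable R) (s : Fin n) where

  private
    -- Saturation: each round adds the head of an arc leaving `X`, which ends because `X` grows
    -- inside a finite set. Once no arc leaves `X`, membership in `X` is reachability.
    grow : (X : Subset n) → Acc _⊃_ X → s ∈ X → (∀ {t} → t ∈ X → Star R s t) →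
           ∀ t → Dec (Star R s t)
    grow X (acc rec) s∈X reach t
      with any? (λ u → any? (λ v → (u ∈? X) ×-dec R? u v ×-dec ¬? (v ∈? X)))
    ... | yes (u , v , u∈X , uv , v∉X) =
      grow (X ∪ ⁅ v ⁆)
        (rec (p⊆p∪q ⁅ v ⁆ , v , q⊆p∪q X ⁅ v ⁆ (x∈⁅x⁆ v) , v∉X))
        (p⊆p∪q ⁅ v ⁆ s∈X)
        ([ reach , (λ t∈v → subst (Star R s) (sym (x∈⁅y⁆⇒x≡y _ t∈v)) (reach u∈X ◅◅ (uv ◅ ε))) ]′
          ∘ x∈p∪q⁻ X ⁅ v ⁆)
        t
    ... | no none = map′ reach (closed s∈X) (t ∈? X)
      where
      closed : ∀ {u v} → u ∈ X → Star R u v → v ∈ X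
      closed u∈X ε = u∈X
      closed {u} u∈X (_◅_ {j = v} uv path) with v ∈? X
      ... | yes v∈X = closed v∈X path
      ... | no v∉X  = contradiction (u , v , u∈X , uv , v∉X) none

  opaque
    star? : ∀ t → Dec (Star R s t)
    star? = grow ⁅ s ⁆ (⊃-wellFounded _) (x∈⁅x⁆ s)
              (λ t∈s → subst (Star R s) (sym (x∈⁅y⁆⇒x≡y _ t∈s)) ε)

open Reachability using (star?) public

-- Perfect matchings of regular matrices

transpose-fixes : ∀ (i j k : Fin n) → k ≢ i → k ≢ j → PC.transpose i j k ≡ k
transpose-fixes i j k k≢i k≢j with k ≟ i
... | yes k≡i = contradiction k≡i k≢i
... | no _ with k ≟ j
...   | yes k≡j = contradiction k≡j k≢j
...   | no _    = refl

transpose-left : ∀ (i j : Fin n) → PC.transpose i j i ≡ j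
transpose-left i j rewrite dec-true (i ≟ i) refl = refl

transpose-right : ∀ (i j : Fin n) → PC.transpose i j j ≡ i
transpose-right i j with j ≟ i
... | yes j≡i = j≡i
... | no _ rewrite dec-true (j ≟ j) refl = refl

data Walk {A : Set} (R : Rel A 0ℓ) : ℕ → A → A → Set where
  []  : ∀ {s} → Walk R 0 s s
  _∷_ : ∀ {k r s t} → R r s → Walk R k s t → Walk R (suc k) r t

walk-map : ∀ {A : Set} {R Q : Rel A 0ℓ} {k s t} → (∀ {u v} → R u v → Q u v) → Walk R k s t → Walk Q k s t
walk-map R⇒Q []      = []
walk-map R⇒Q (r ∷ w) = R⇒Q r ∷ walk-map R⇒Q w

star⇒walk : ∀ {A : Set} {R : Rel A 0ℓ} {s t} → Star R s t → ∃ λ k → Walk R k s t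
star⇒walk ε       = 0 , []
star⇒walk (r ◅ p) = let k , w = star⇒walk p in suc k , r ∷ w

-- A walk of such steps starting in `s` never returns to `s`. This is the part of simplicity that
-- `rotate` uses; `from-last-visit` restores it at each new starting vertex.
NeverBackTo : Fin n → Rel (Fin n) 0ℓ → Rel (Fin n) 0ℓ
NeverBackTo s R u v = R u v × v ≢ s

last-visit : ∀ {R : Rel (Fin n) 0ℓ} s {k r t} → Walk R k r t →
             Walk (NeverBackTo s R) k r t ⊎ ∃ λ j → j ℕ.≤ k × Walk (NeverBackTo s R) j s t
last-visit s [] = inj₁ []
last-visit s (_∷_ {k = k} {s = r} a w) with last-visit s w
... | inj₂ (j , j≤k , w′) = inj₂ (j , ℕ.m≤n⇒m≤1+n j≤k , w′)
... | inj₁ w′ with r ≟ s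
...   | yes refl = inj₂ (k , ℕ.n≤1+n k , w′)
...   | no r≢s   = inj₁ ((a , r≢s) ∷ w′)

from-last-visit : ∀ {R : Rel (Fin n) 0ℓ} {k s t} → Walk R k s t →
                  ∃ λ j → j ℕ.≤ k × Walk (NeverBackTo s R) j s t
from-last-visit {k = k} {s} w with last-visit s w
... | inj₁ w′ = k , ℕ.≤-refl , w′
... | inj₂ x  = x

-- Rotates the images under m along a simple cycle s → ⋯ → t → s of the
-- relation "u has an arc to the image of v", one transposition per arc.
rotate : ∀ (f : Matrix n) fuel {k} → k ℕ.≤ fuel → ∀ m {s t} →
         Walk (NeverBackTo s (λ u v → T (f u (m ⟨$⟩ʳ v)))) k s t → T (f t (m ⟨$⟩ʳ s)) →
         ∃ λ (m′ : Permutation′ n) → T (f s (m′ ⟨$⟩ʳ s)) ×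
           (∀ v → v ≢ s → T (f v (m ⟨$⟩ʳ v)) → T (f v (m′ ⟨$⟩ʳ v)))
rotate f fuel _ m [] ts = m , ts , λ _ _ good → good
rotate f (suc fuel) (s≤s k≤) m {s} {t} (_∷_ {s = s′} (ss′ , s′≢s) w) ts =
  -- The transposition gives `s` an image it has an arc to and hands the old image of `s` to `s′`,
  -- so the arc from `t` now closes a shorter cycle at `s′`. All heads on `w₁` avoid `s` and `s′`,
  -- where alone `m₁` differs from `m`. Cutting at the last visit is not structural, hence the fuel.
  let j , j≤k , w₁ = from-last-visit w
      m₂ , good-s′ , keep = rotate f fuel (ℕ.≤-trans j≤k k≤) m₁
        (walk-map (λ { {u} {v} ((uv , v≢s) , v≢s′) → subst (λ x → T (f u x)) (sym (m₁-other v v≢s v≢s′)) uv , v≢s′ }) w₁)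
        (subst (λ x → T (f t (m ⟨$⟩ʳ x))) (sym (transpose-right s s′)) ts)
  in m₂
   , keep s (s′≢s ∘ sym) (subst (λ x → T (f s (m ⟨$⟩ʳ x))) (sym (transpose-left s s′)) ss′)
   , λ v v≢s good → case-s′ m₂ good-s′ keep v v≢s good (v ≟ s′)
  where
  m₁ = transpose s s′ ∘ₚ m
  m₁-other : ∀ v → v ≢ s → v ≢ s′ → m₁ ⟨$⟩ʳ v ≡ m ⟨$⟩ʳ v
  m₁-other v v≢s v≢s′ = cong (m ⟨$⟩ʳ_) (transpose-fixes s s′ v v≢s v≢s′)
  case-s′ : ∀ m₂ → T (f s′ (m₂ ⟨$⟩ʳ s′)) →
            (∀ v → v ≢ s′ → T (f v (m₁ ⟨$⟩ʳ v)) → T (f v (m₂ ⟨$⟩ʳ v))) →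
            ∀ v → v ≢ s → T (f v (m ⟨$⟩ʳ v)) → Dec (v ≡ s′) → T (f v (m₂ ⟨$⟩ʳ v))
  case-s′ m₂ good keep v v≢s good-v (yes refl) = good
  case-s′ m₂ good keep v v≢s good-v (no v≢s′)  =
    keep v v≢s′ (subst (λ x → T (f v x)) (sym (m₁-other v v≢s v≢s′)) good-v)

-- By regularity every vertex s lies on a cycle of that relation: the set
-- reachable from s contains an in-neighbour of s.
improve : ∀ (f : Matrix n) → Regular (suc e) f → ∀ m s →
          ∃ λ (m′ : Permutation′ n) → T (f s (m′ ⟨$⟩ʳ s)) ×
            (∀ v → v ≢ s → T (f v (m ⟨$⟩ʳ v)) → T (f v (m′ ⟨$⟩ʳ v)))
improve f (r , c) m s =
  let t , ts = sum-witness (λ v → f v (m ⟨$⟩ʳ s)) (c (m ⟨$⟩ʳ s))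
      reach  = closed-backwards regular (star? (λ u v → T? (f u (m ⟨$⟩ʳ v))) s)
                 (λ uv su → su ◅◅ (uv ◅ ε)) ts ε
      k , w  = star⇒walk reach
      j , _ , w′ = from-last-visit w
  in rotate f j ℕ.≤-refl m w′ ts
  where
  regular : Regular _ (λ u v → f u (m ⟨$⟩ʳ v))
  regular = (λ u → trans (sym (ℕ∑.sum-permute (λ v → χ (f u v)) m)) (r u)) , (λ v → c (m ⟨$⟩ʳ v))

opaque
  -- A full permutation is carried along from the identity; only its arcs at the first `k` vertices
  -- are required to lie in `f`, and `improve` repairs the next vertex without spoiling those.
  könig : ∀ (f : Matrix n) → Regular (suc e) f → ∃ λ (m : Permutation′ n) → ∀ u → T (f u (m ⟨$⟩ʳ u))
  könig {n} f reg = let m , good = upTo n ℕ.≤-refl in m , λ u → good u (toℕ<n u)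
    where
    upTo : ∀ k → k ℕ.≤ n → ∃ λ (m : Permutation′ n) → ∀ u → toℕ u ℕ.< k → T (f u (m ⟨$⟩ʳ u))
    upTo zero    _   = Perm.id , λ _ ()
    upTo (suc k) k<n = let m , good = upTo k (ℕ.<⇒≤ k<n)
                           m′ , good-s , keep = improve f reg m s
                       in m′ , λ u u<1+k → extend m m′ good good-s keep u (u ≟ s) u<1+k
      where
      s : Fin n
      s = fromℕ< k<n
      extend : ∀ (m m′ : Permutation′ n) → (∀ u → toℕ u ℕ.< k → T (f u (m ⟨$⟩ʳ u))) → T (f s (m′ ⟨$⟩ʳ s)) →
               (∀ v → v ≢ s → T (f v (m ⟨$⟩ʳ v)) → T (f v (m′ ⟨$⟩ʳ v))) →
               ∀ u → Dec (u ≡ s) → toℕ u ℕ.< suc k → T (f u (m′ ⟨$⟩ʳ u))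
      extend m m′ good good-s keep u (yes refl) _ = good-s
      extend m m′ good good-s keep u (no u≢s) u<1+k = keep u u≢s
        (good u (ℕ.≤∧≢⇒< (ℕ.≤-pred u<1+k) (λ u≡k → u≢s (toℕ-injective (trans u≡k (sym (toℕ-fromℕ< k<n)))))))

-- Hamiltonian cycles

card-tabulate : (p : Fin n → Bool) → ∣ tabulate p ∣ ≡ ℕ∑.sum (χ ∘ p)
card-tabulate {zero}  p = refl
card-tabulate {suc n} p with p zero
... | true  = cong suc (card-tabulate (p ∘ suc))
... | false = card-tabulate (p ∘ suc)

factor⇒regular : ∀ {F : Subgraph n} → Factor e F → Regular e (arc F)
factor⇒regular {F = F} factor =
  (λ u → trans (sym (card-tabulate (arc F u))) (proj₂ (factor u))) ,
  (λ v → trans (sym (card-tabulate (flip (arc F) v))) (proj₁ (factor v)))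

regular⇒factor : ∀ {F : Subgraph n} → Regular e (arc F) → Factor e F
regular⇒factor {F = F} (r , c) u =
  trans (card-tabulate (flip (arc F) u)) (c u) , trans (card-tabulate (arc F u)) (r u)

next-mod : ∀ k → next {suc n} (k mod suc n) ≡ suc k mod suc n
next-mod {n} k = toℕ-injective (begin
  toℕ (suc (toℕ (k mod N)) mod N)      ≡⟨ toℕ-fromℕ< (m%n<n (suc (toℕ (k mod N))) N) ⟩
  suc (toℕ (k mod N)) % N              ≡⟨ cong (λ x → suc x % N) (toℕ-fromℕ< (m%n<n k N)) ⟩
  suc (k % N) % N                      ≡⟨ %-distribˡ-+ 1 (k % N) N ⟩
  ((1 % N) ℕ.+ ((k % N) % N)) % N      ≡⟨ cong (λ x → ((1 % N) ℕ.+ x) % N) (m%n%n≡m%n k N) ⟩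
  ((1 % N) ℕ.+ (k % N)) % N            ≡⟨ %-distribˡ-+ 1 k N ⟨
  suc k % N                            ≡⟨ toℕ-fromℕ< (m%n<n (suc k) N) ⟨
  toℕ (suc k mod N)                    ∎)
  where
  open ≡-Reasoning
  N = suc n

toℕ-mod : ∀ (i : Fin (suc n)) → toℕ i mod suc n ≡ i
toℕ-mod {n} i = toℕ-injective (trans (toℕ-fromℕ< (m%n<n (toℕ i) (suc n))) (m<n⇒m%n≡m (toℕ<n i)))

next-transitive : ∀ {p} (P : Fin n → Set p) → (∀ i → P i → P (next i)) → ∀ {i} → P i → ∀ j → P j
next-transitive {suc n} P step {i} Pi j =
  -- From `i`, `j + (N - i)` steps lead to `j + N`, which is `j` modulo `N`; this treats `i ≤ j` and
  -- `j < i` alike.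
  subst P (trans (toℕ-injective eq) (toℕ-mod j)) (steps (toℕ j ℕ.+ (N ∸ toℕ i)) (subst P (sym (toℕ-mod i)) Pi))
  where
  open ≡-Reasoning
  N = suc n
  steps : ∀ k → P (toℕ i mod N) → P ((k ℕ.+ toℕ i) mod N)
  steps zero    p = p
  steps (suc k) p = subst P (next-mod (k ℕ.+ toℕ i)) (step _ (steps k p))
  eq : toℕ (((toℕ j ℕ.+ (N ∸ toℕ i)) ℕ.+ toℕ i) mod N) ≡ toℕ (toℕ j mod N)
  eq = begin
    toℕ (((toℕ j ℕ.+ (N ∸ toℕ i)) ℕ.+ toℕ i) mod N) ≡⟨ toℕ-fromℕ< (m%n<n ((toℕ j ℕ.+ (N ∸ toℕ i)) ℕ.+ toℕ i) N) ⟩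
    ((toℕ j ℕ.+ (N ∸ toℕ i)) ℕ.+ toℕ i) % N         ≡⟨ cong (_% N) (ℕ.+-assoc (toℕ j) _ _) ⟩
    (toℕ j ℕ.+ ((N ∸ toℕ i) ℕ.+ toℕ i)) % N         ≡⟨ cong (λ x → (toℕ j ℕ.+ x) % N) (ℕ.m∸n+n≡m (ℕ.<⇒≤ (toℕ<n i))) ⟩
    (toℕ j ℕ.+ N) % N                               ≡⟨ [m+n]%n≡m%n (toℕ j) N ⟩
    toℕ j % N                                       ≡⟨ toℕ-fromℕ< (m%n<n (toℕ j) N) ⟨
    toℕ (toℕ j mod N)                               ∎

permutation-injective : ∀ (m : Permutation′ n) {u v} → m ⟨$⟩ʳ u ≡ m ⟨$⟩ʳ v → u ≡ v
permutation-injective m = Injection.injective (↔⇒↣ m)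

module CyclicPermutation (m : Permutation′ (suc n))
         (transitive : ∀ u v → EqClosure (λ u v → m ⟨$⟩ʳ u ≡ v) u v) where

  private
    N = suc n

  orbit : ℕ → Fin N
  orbit zero    = zero
  orbit (suc k) = m ⟨$⟩ʳ orbit k

  -- Once the orbit of `zero` closes up, the vertices listed so far are closed under `m` and its
  -- inverse, so by transitivity they are all the vertices.
  period⇒surjective : ∀ k → orbit (suc k) ≡ zero → ∀ y → ∃ λ r → r ℕ.< suc k × orbit r ≡ y
  period⇒surjective k period y = along (transitive zero y) (0 , ℕ.z<s , refl)
    where
    P : Fin N → Set
    P y = ∃ λ r → r ℕ.< suc k × orbit r ≡ y
    step : ∀ {u v} → SymClosure (λ u v → m ⟨$⟩ʳ u ≡ v) u v → P u → P v
    step (fwd refl) (r , s≤s r≤k , refl) with r ℕ.≟ k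
    ... | yes refl = 0 , ℕ.z<s , sym period
    ... | no r≢k   = suc r , s≤s (ℕ.≤∧≢⇒< r≤k r≢k) , refl
    step (bwd refl) (zero  , _ , eq) = k , ℕ.≤-refl , permutation-injective m (trans period eq)
    step (bwd refl) (suc r , r<k , eq) = r , ℕ.<-trans (ℕ.n<1+n r) r<k , permutation-injective m eq
    along : ∀ {u v} → EqClosure (λ u v → m ⟨$⟩ʳ u ≡ v) u v → P u → P v
    along ε       = id
    along (s ◅ p) = along p ∘ step s

  period-≥ : ∀ k → orbit (suc k) ≡ zero → N ℕ.≤ suc k
  period-≥ k period = injective⇒≤ {f = index} λ {x} {y} eq →
    trans (sym (orbit-index x)) (trans (cong (orbit ∘ toℕ) eq) (orbit-index y))
    where
    index : Fin N → Fin (suc k)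
    index y = fromℕ< (proj₁ (proj₂ (period⇒surjective k period y)))
    orbit-index : ∀ y → orbit (toℕ (index y)) ≡ y
    orbit-index y = let r , r< , eq = period⇒surjective k period y in trans (cong orbit (toℕ-fromℕ< r<)) eq

  -- Injectivity of `m` strips the last step off both sides until the earlier visit is `zero`
  -- itself.
  repeat⇒period : ∀ {i j} → i ℕ.< j → orbit i ≡ orbit j → ∃ λ k → suc k ℕ.≤ j × orbit (suc k) ≡ zero
  repeat⇒period {zero}  {suc j} _ eq = j , ℕ.≤-refl , sym eq
  repeat⇒period {suc i} {suc j} (s≤s i<j) eq =
    let k , k<j , period = repeat⇒period i<j (permutation-injective m eq)
    in k , ℕ.m≤n⇒m≤1+n k<j , period

  orbit-N : orbit N ≡ zero
  -- Pigeonhole on `N + 1` orbit points gives a return to `zero` within `N` steps; `period-≥`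
  -- excludes an earlier one.
  orbit-N with pigeonhole (ℕ.n<1+n N) (orbit ∘ toℕ)
  ... | i , j , i<j , eq =
    let k , k<j , period = repeat⇒period i<j eq
    in trans (cong orbit (ℕ.≤-antisym (period-≥ k period)
         (ℕ.≤-trans k<j (ℕ.≤-pred (toℕ<n j))))) period

  no-repeat : ∀ (i j : Fin N) → toℕ i ℕ.< toℕ j → orbit (toℕ i) ≢ orbit (toℕ j)
  no-repeat i j i<j eq = let k , k<j , period = repeat⇒period i<j eq in
    ℕ.<-irrefl refl (ℕ.<-≤-trans (toℕ<n j) (ℕ.≤-trans (period-≥ k period) k<j))

  orbit-injective : ∀ (i j : Fin N) → orbit (toℕ i) ≡ orbit (toℕ j) → i ≡ j
  orbit-injective i j eq with <-cmp i j
  ... | tri< i<j _ _ = contradiction eq (no-repeat i j i<j)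
  ... | tri≈ _ i≡j _ = i≡j
  ... | tri> _ _ j<i = contradiction (sym eq) (no-repeat j i j<i)

  index : Fin N → Fin N
  index y = fromℕ< (proj₁ (proj₂ (period⇒surjective n orbit-N y)))

  orbit-index : ∀ y → orbit (toℕ (index y)) ≡ y
  orbit-index y = let r , r< , eq = period⇒surjective n orbit-N y in trans (cong orbit (toℕ-fromℕ< r<)) eq

  enumeration : Permutation′ N
  enumeration = Perm.permutation (orbit ∘ toℕ) index orbit-index
    (λ i → orbit-injective _ _ (orbit-index (orbit (toℕ i))))

  enumeration-next : ∀ i → enumeration ⟨$⟩ʳ next i ≡ m ⟨$⟩ʳ (enumeration ⟨$⟩ʳ i)
  enumeration-next i = trans (cong orbit (toℕ-fromℕ< (m%n<n (suc (toℕ i)) N))) (wrap (suc (toℕ i)) (toℕ<n i))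
    where
    wrap : ∀ k → k ℕ.≤ N → orbit (k % N) ≡ orbit k
    wrap k k≤N with k ℕ.≟ N
    ... | yes refl = trans (cong orbit (n%n≡0 N)) (sym orbit-N)
    ... | no k≢N   = cong orbit (m<n⇒m%n≡m (ℕ.≤∧≢⇒< k≤N k≢N))

  hamiltonian : ∀ {F : Subgraph N} →
                (∀ u v → (T (arc F u v) → m ⟨$⟩ʳ u ≡ v) × (m ⟨$⟩ʳ u ≡ v → T (arc F u v))) →
                HamiltonianCycle F
  hamiltonian arcs = enumeration , λ u v → mk⇔
    (λ uv → index u , orbit-index u ,
      trans (enumeration-next (index u)) (trans (cong (m ⟨$⟩ʳ_) (orbit-index u)) (proj₁ (arcs u v) uv)))
    (λ { (i , refl , refl) → proj₂ (arcs _ _) (sym (enumeration-next i)) })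

outRegular-0⇒empty : ∀ {f : Matrix n} → OutRegular 0 f → ∀ {u v} → ¬ T (f u v)
outRegular-0⇒empty {n} {f} empty {u} {v} uv = contradiction
  (sum-≡⇒≗ {a = λ _ → 0} {χ ∘ f u} (λ _ → z≤n) (trans (ℕ∑.sum-replicate-zero n) (sym (empty u))) v)
  (subst (λ b → 0 ≢ χ b) (sym (Equivalence.to T-≡ uv)) λ ())

-- Removing the matching found by `könig` leaves a 0-regular matrix, which has no arcs, so the
-- matching was all of `F`.
one-factor-arcs : ∀ {F : Subgraph n} → Factor 1 F → ∃ λ (m : Permutation′ n) → ∀ u v →
                  (T (arc F u v) → m ⟨$⟩ʳ u ≡ v) × (m ⟨$⟩ʳ u ≡ v → T (arc F u v))
one-factor-arcs {F = F} factor =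
  let reg = factor⇒regular {F = F} factor
      m , m⊆F = könig (arc F) reg
      rest = regular-delete (splits-delete (arc F) m m⊆F) reg
  in m , λ u v → only m (proj₁ rest) , (λ { refl → m⊆F u })
  where
  only : ∀ m → OutRegular 0 (delete (arc F) m) → ∀ {u v} → T (arc F u v) → m ⟨$⟩ʳ u ≡ v
  only m empty {u} {v} uv with m ⟨$⟩ʳ u ≟ v
  ... | yes mu≡v = mu≡v
  ... | no mu≢v  = contradiction (delete-∋ (arc F) m uv mu≢v) (outRegular-0⇒empty {f = delete (arc F) m} empty)

connected-1-factor⇒hamiltonian : ∀ {F : Subgraph n} → ConnectedFactor 1 F → HamiltonianCycle F
connected-1-factor⇒hamiltonian {zero} _ = Perm.id , λ ()
connected-1-factor⇒hamiltonian {suc n} {F} (factor , connected) =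
  let m , arcs = one-factor-arcs {F = F} factor
  in CyclicPermutation.hamiltonian m (λ u v → EqC.map (proj₁ (arcs _ _)) (connected u v)) {F} arcs

-- Ordered fields

module OrderedFieldProperties {a ℓ₁ ℓ₂} (K : OrderedField a ℓ₁ ℓ₂) where

  open OrderedField K hiding (sum; zero)
    renaming (refl to ≈-refl; sym to ≈-sym; trans to ≈-trans)
  open MatrixSums +-commutativeMonoid public
  open IsTotalOrder isTotalOrder public using (total; antisym)
    renaming (refl to ≤-refl; trans to ≤-trans; reflexive to ≤-reflexive)
  open RingProperties ring

  poset : Poset a ℓ₁ ℓ₂
  poset = record { isPartialOrder = IsTotalOrder.isPartialOrder isTotalOrder }

  module ≤-Reasoning = PosetReasoning poset
  open ≤-Reasoning

  +-monoʳ-≤ : ∀ z {x y} → x ≤ y → z + x ≤ z + y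
  +-monoʳ-≤ z {x} {y} x≤y = begin
    z + x ≈⟨ +-comm z x ⟩
    x + z ≤⟨ +-monoˡ-≤ z x≤y ⟩
    y + z ≈⟨ +-comm y z ⟩
    z + y ∎

  +-mono-≤ : ∀ {x y u v} → x ≤ y → u ≤ v → x + u ≤ y + v
  +-mono-≤ {x} {y} {u} {v} x≤y u≤v = ≤-trans (+-monoˡ-≤ u x≤y) (+-monoʳ-≤ y u≤v)

  +-cancelʳ-≤ : ∀ z {x y} → x + z ≤ y + z → x ≤ y
  +-cancelʳ-≤ z {x} {y} le = begin
    x               ≈⟨ //-rightDividesʳ z x ⟨
    (x + z) - z     ≤⟨ +-monoˡ-≤ (- z) le ⟩
    (y + z) - z     ≈⟨ //-rightDividesʳ z y ⟩
    y               ∎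

  x≤x+y : ∀ x {y} → 0# ≤ y → x ≤ x + y
  x≤x+y x {y} 0≤y = begin
    x      ≈⟨ +-identityʳ x ⟨
    x + 0# ≤⟨ +-monoʳ-≤ x 0≤y ⟩
    x + y  ∎

  x≤y⇒0≤y-x : ∀ {x y} → x ≤ y → 0# ≤ y - x
  x≤y⇒0≤y-x {x} {y} x≤y = begin
    0#    ≈⟨ -‿inverseʳ x ⟨
    x - x ≤⟨ +-monoˡ-≤ (- x) x≤y ⟩
    y - x ∎

  *-monoˡ-≤ : ∀ {z x y} → 0# ≤ z → x ≤ y → z * x ≤ z * y
  *-monoˡ-≤ {z} {x} {y} 0≤z x≤y = begin
    z * x                 ≈⟨ +-identityˡ (z * x) ⟨
    0# + z * x            ≤⟨ +-monoˡ-≤ (z * x) (*-nonNeg 0≤z (x≤y⇒0≤y-x x≤y)) ⟩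
    z * (y - x) + z * x   ≈⟨ distribˡ z (y - x) x ⟨
    z * ((y - x) + x)     ≈⟨ *-congˡ (//-rightDividesˡ x y) ⟩
    z * y                 ∎

  0≤1 : 0# ≤ 1#
  0≤1 with total 0# 1#
  ... | inj₁ 0≤1 = 0≤1
  ... | inj₂ 1≤0 = begin
    0#          ≤⟨ *-nonNeg 0≤-1 0≤-1 ⟩
    - 1# * - 1# ≈⟨ -1*x≈-x (- 1#) ⟩
    - - 1#      ≈⟨ -‿involutive 1# ⟩
    1#          ∎
    where
    0≤-1 : 0# ≤ - 1#
    0≤-1 = ≤-trans (x≤y⇒0≤y-x 1≤0) (≤-reflexive (+-identityˡ (- 1#)))

  1≰0 : ¬ (1# ≤ 0#)
  1≰0 1≤0 = 0≉1 (antisym 0≤1 1≤0)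

  0≤fromℕ : ∀ k → 0# ≤ fromℕ k
  0≤fromℕ zero    = ≤-refl
  0≤fromℕ (suc k) = ≤-trans 0≤1 (x≤x+y 1# (0≤fromℕ k))

  1≤fromℕ-suc : ∀ k → 1# ≤ fromℕ (suc k)
  1≤fromℕ-suc k = x≤x+y 1# (0≤fromℕ k)

  fromℕ-suc≉0 : ∀ k → ¬ (fromℕ (suc k) ≈ 0#)
  fromℕ-suc≉0 k eq = 1≰0 (≤-trans (1≤fromℕ-suc k) (≤-reflexive eq))

  0≤fromℕ-suc⁻¹ : ∀ k → 0# ≤ fromℕ (suc k) ⁻¹
  0≤fromℕ-suc⁻¹ k with total 0# (fromℕ (suc k) ⁻¹)
  ... | inj₁ 0≤ = 0≤
  ... | inj₂ ≤0 = contradiction (begin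
    1#                              ≈⟨ *-inverseʳ (fromℕ-suc≉0 k) ⟨
    fromℕ (suc k) * fromℕ (suc k) ⁻¹ ≤⟨ *-monoˡ-≤ (0≤fromℕ (suc k)) ≤0 ⟩
    fromℕ (suc k) * 0#              ≈⟨ zeroʳ _ ⟩
    0#                              ∎) 1≰0

  ∑-mono-≤ : ∀ {n} {f g : Fin n → Carrier} → (∀ i → f i ≤ g i) → sum f ≤ sum g
  ∑-mono-≤ {zero}  le = ≤-refl
  ∑-mono-≤ {suc n} le = +-mono-≤ (le zero) (∑-mono-≤ (le ∘ suc))

  sum-nonNeg : ∀ {n} {f : Fin n → Carrier} → (∀ i → 0# ≤ f i) → 0# ≤ sum f
  sum-nonNeg {zero}  nn = ≤-refl
  sum-nonNeg {suc n} nn = ≤-trans (nn zero) (x≤x+y _ (sum-nonNeg (nn ∘ suc)))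

  sum-indicator : ∀ {n} (p : Fin n → Bool) {k} → ℕ∑.sum (χ ∘ p) ≡ k →
              sum (λ i → if p i then 1# else 0#) ≈ fromℕ k
  sum-indicator {zero}  p refl = ≈-refl
  sum-indicator {suc n} p refl with p zero
  ... | true  = +-congˡ (sum-indicator (p ∘ suc) refl)
  ... | false = ≈-trans (+-identityˡ _) (sum-indicator (p ∘ suc) refl)

  -- Every tightness proof ends here: if an instance attains the constant `c` with `b ≥ 1`, then the
  -- constant `c - η` would give `η ≤ η * b ≤ 0`.
  no-slack : ∀ {x c b η} → c * b ≤ x → 1# ≤ b → 0# < η → ¬ (x ≤ (c - η) * b)
  no-slack {x} {c} {b} {η} cb≤x 1≤b (0≤η , 0≉η) x≤ = 0≉η (antisym 0≤η (begin
    η            ≈⟨ *-identityʳ η ⟨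
    η * 1#       ≤⟨ *-monoˡ-≤ 0≤η 1≤b ⟩
    η * b        ≤⟨ +-cancelʳ-≤ x ηb+x≤0+x ⟩
    0#           ∎))
    where
    ηb+x≤0+x : η * b + x ≤ 0# + x
    ηb+x≤0+x = begin
      η * b + x               ≤⟨ +-monoʳ-≤ (η * b) x≤ ⟩
      η * b + (c - η) * b     ≈⟨ distribʳ b η (c - η) ⟨
      (η + (c - η)) * b       ≈⟨ *-congʳ (≈-trans (+-comm η (c - η)) (//-rightDividesˡ η c)) ⟩
      c * b                   ≤⟨ cb≤x ⟩
      x                       ≈⟨ +-identityˡ x ⟨
      0# + x                  ∎

  x+y≤z⇒x≤z-y : ∀ {x y z} → x + y ≤ z → x ≤ z - y
  x+y≤z⇒x≤z-y {x} {y} {z} le = begin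
    x           ≈⟨ //-rightDividesʳ y x ⟨
    (x + y) - y ≤⟨ +-monoˡ-≤ (- y) le ⟩
    z - y       ∎

  /-cancel : ∀ k x → (x / fromℕ (suc k)) * fromℕ (suc k) ≈ x
  /-cancel k x = begin-equality
    (x / d) * d       ≈⟨ *-assoc x (d ⁻¹) d ⟩
    x * (d ⁻¹ * d)    ≈⟨ *-congˡ (≈-trans (*-comm (d ⁻¹) d) (*-inverseʳ (fromℕ-suc≉0 k))) ⟩
    x * 1#            ≈⟨ *-identityʳ x ⟩
    x                 ∎
    where d = fromℕ (suc k)

  -- Averaging over the matchings of a factor in closed form: `y - x` bounds each of `k + 1`
  -- matchings that together weigh `y`, and rearranging gives `(k + 1) * x ≤ k * y`.
  average : ∀ k {x y} → y ≤ fromℕ (suc k) * (y - x) → x ≤ (fromℕ k / fromℕ (suc k)) * y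
  average k {x} {y} le = begin
    x                         ≈⟨ /-cancel k x ⟨
    (x * d ⁻¹) * d            ≈⟨ *-congʳ (*-comm x (d ⁻¹)) ⟩
    (d ⁻¹ * x) * d            ≈⟨ *-assoc (d ⁻¹) x d ⟩
    d ⁻¹ * (x * d)            ≈⟨ *-congˡ (*-comm x d) ⟩
    d ⁻¹ * (d * x)            ≤⟨ *-monoˡ-≤ (0≤fromℕ-suc⁻¹ k) (+-cancelʳ-≤ y dx+y≤ky+y) ⟩
    d ⁻¹ * (fromℕ k * y)      ≈⟨ *-assoc (d ⁻¹) (fromℕ k) y ⟨
    (d ⁻¹ * fromℕ k) * y      ≈⟨ *-congʳ (*-comm (d ⁻¹) (fromℕ k)) ⟩
    (fromℕ k / d) * y         ∎
    where
    d = fromℕ (suc k)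
    dx+y≤ky+y : d * x + y ≤ fromℕ k * y + y
    dx+y≤ky+y = begin
      d * x + y               ≤⟨ +-monoʳ-≤ (d * x) le ⟩
      d * x + d * (y - x)     ≈⟨ distribˡ d x (y - x) ⟨
      d * (x + (y - x))       ≈⟨ *-congˡ (≈-trans (+-comm x (y - x)) (//-rightDividesˡ x y)) ⟩
      d * y                   ≈⟨ distribʳ y 1# (fromℕ k) ⟩
      1# * y + fromℕ k * y    ≈⟨ +-comm (1# * y) (fromℕ k * y) ⟩
      fromℕ k * y + 1# * y    ≈⟨ +-congˡ (*-identityˡ y) ⟩
      fromℕ k * y + y         ∎

  summand≤sum : ∀ {n} {f : Fin n → Carrier} i → (∀ j → 0# ≤ f j) → f i ≤ sum f
  summand≤sum zero    nonNeg = x≤x+y _ (sum-nonNeg (nonNeg ∘ suc))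
  summand≤sum {f = f} (suc i) nonNeg = begin
    f (suc i)               ≤⟨ summand≤sum i (nonNeg ∘ suc) ⟩
    sum (f ∘ suc)           ≤⟨ x≤x+y _ (nonNeg zero) ⟩
    sum (f ∘ suc) + f zero  ≈⟨ +-comm _ _ ⟩
    f zero + sum (f ∘ suc)  ∎

-- Rejoining the components of a regular digraph along a permutation

eqClosure? : {R : Rel (Fin n) 0ℓ} → Decidable R → Decidable (EqClosure R)
eqClosure? {R = R} R? = star? λ u v → map′ [ fwd , bwd ]′ (λ { (fwd r) → inj₁ r ; (bwd r) → inj₂ r }) (R? u v ⊎-dec R? v u)

Graph : Permutation′ n → Rel (Fin n) 0ℓ
Graph m u v = m ⟨$⟩ʳ u ≡ v

SameComponent : Matrix n → Rel (Fin n) 0ℓ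
SameComponent f = EqClosure λ u v → T (f u v)

SameOrbit : Permutation′ n → Rel (Fin n) 0ℓ
SameOrbit m = EqClosure (Graph m)

-- Connectedness by `f` and `m` together, where `m` holds arcs not yet realised in `f`. Reconnection
-- trades `m` for arcs of `f` while this relation stays total.
Joined : Matrix n → Permutation′ n → Rel (Fin n) 0ℓ
Joined f m = EqClosure λ u v → T (f u v) ⊎ Graph m u v

sameComponent? : (f : Matrix n) → Decidable (SameComponent f)
sameComponent? f = eqClosure? λ u v → T? (f u v)

sameOrbit? : (m : Permutation′ n) → Decidable (SameOrbit m)
sameOrbit? m = eqClosure? λ u v → m ⟨$⟩ʳ u ≟ v

≡⇒eqClosure : {R : Rel (Fin n) 0ℓ} → ∀ {u v} → u ≡ v → EqClosure R u v
≡⇒eqClosure refl = ε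

eqClosure-sym : {R : Rel (Fin n) 0ℓ} → ∀ {u v} → EqClosure R u v → EqClosure R v u
eqClosure-sym {R = R} = EqC.symmetric R

-- The moved vertices; their strict decrease is the termination measure of `reconnect`.
support : Permutation′ n → Subset n
support m = tabulate λ u → not (does (m ⟨$⟩ʳ u ≟ u))

∈-support⁺ : ∀ (m : Permutation′ n) {u} → m ⟨$⟩ʳ u ≢ u → u ∈ support m
∈-support⁺ m {u} mu≢u = lookup⇒[]= u _ (trans (lookup∘tabulate _ u) (cong not (dec-false (m ⟨$⟩ʳ u ≟ u) mu≢u)))

∈-support⁻ : ∀ (m : Permutation′ n) {u} → u ∈ support m → m ⟨$⟩ʳ u ≢ u
∈-support⁻ m {u} u∈ mu≡u with () ← trans (sym ([]=⇒lookup u∈)) (trans (lookup∘tabulate _ u) (cong not (dec-true (m ⟨$⟩ʳ u ≟ u) mu≡u)))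

support-⊂ : ∀ (m m′ : Permutation′ n) → (∀ {u} → m ⟨$⟩ʳ u ≡ u → m′ ⟨$⟩ʳ u ≡ u) →
            ∀ {x} → m ⟨$⟩ʳ x ≢ x → m′ ⟨$⟩ʳ x ≡ x → support m′ ⊂ support m
support-⊂ m m′ fix {x} mx≢x m′x≡x =
  (λ u∈ → ∈-support⁺ m (∈-support⁻ m′ u∈ ∘ fix)) ,
  x , ∈-support⁺ m mx≢x , λ x∈ → ∈-support⁻ m′ x∈ m′x≡x

-- Shortcuts the vertex y out of its orbit: p → y → q becomes p → q.
module Bypass (m : Permutation′ n) (y : Fin n) (y-moved : m ⟨$⟩ʳ y ≢ y) where

  private
    q = m ⟨$⟩ʳ y

  bypass : Permutation′ n
  bypass = m ∘ₚ transpose y q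

  bypass-self : bypass ⟨$⟩ʳ y ≡ y
  bypass-self = transpose-right y q

  bypass-before : ∀ {u} → m ⟨$⟩ʳ u ≡ y → bypass ⟨$⟩ʳ u ≡ q
  bypass-before refl = transpose-left y q

  bypass-other : ∀ {u} → u ≢ y → m ⟨$⟩ʳ u ≢ y → bypass ⟨$⟩ʳ u ≡ m ⟨$⟩ʳ u
  bypass-other u≢y mu≢y = transpose-fixes y q _ mu≢y (u≢y ∘ permutation-injective m)

  bypass-support : support bypass ⊂ support m
  bypass-support = support-⊂ m bypass
    (λ {u} mu≡u → trans (bypass-other {u} (λ { refl → y-moved mu≡u }) (λ mu≡y → y-moved
      (subst (λ v → m ⟨$⟩ʳ v ≡ v) (trans (sym mu≡u) mu≡y) mu≡u))) mu≡u)
    y-moved bypass-self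

  private
    -- Retracts the old orbit onto its part without `y` by sending `y` to its successor; each step
    -- of `m` then becomes a step of `bypass` or an equality.
    skip : Fin n → Fin n
    skip u with u ≟ y
    ... | yes _ = q
    ... | no _  = u

    skip-self : skip y ≡ q
    skip-self with y ≟ y
    ... | yes _  = refl
    ... | no y≢y = contradiction refl y≢y

    skip-other : ∀ {u} → u ≢ y → skip u ≡ u
    skip-other {u} u≢y with u ≟ y
    ... | yes u≡y = contradiction u≡y u≢y
    ... | no _    = refl

    skip-step : ∀ {u v} → m ⟨$⟩ʳ u ≡ v → SameOrbit bypass (skip u) (skip v)
    skip-step {u} refl with u ≟ y
    ... | yes refl = ≡⇒eqClosure (sym (skip-other y-moved))
    ... | no u≢y with m ⟨$⟩ʳ u ≟ y
    ...   | yes mu≡y = EqC.return (bypass-before mu≡y)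
    ...   | no mu≢y  = EqC.return (bypass-other u≢y mu≢y)

  bypass-orbit : ∀ {z} → z ≢ y → SameOrbit m y z → SameOrbit bypass q z
  bypass-orbit z≢y y∼z = subst₂ (SameOrbit bypass) skip-self (skip-other z≢y)
    (EqC.gfold (EqC.isEquivalence _) skip skip-step y∼z)

  -- Although `y` is cut out of its orbit, it stays attached: it shares a component of `f` with `z`,
  -- and `z` still shares an orbit with the successor `q`.
  bypass-joined : ∀ (f : Matrix n) {z} → z ≢ y → SameOrbit m y z → SameComponent f y z →
                  ∀ {u v} → Joined f m u v → Joined f bypass u v
  bypass-joined f {z} z≢y orbit component = EqC.fold (EqC.isEquivalence _) step
    where
    y∼q : Joined f bypass y q
    y∼q = EqC.map inj₁ component ◅◅ eqClosure-sym (EqC.map inj₂ (bypass-orbit z≢y orbit))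
    step : ∀ {u v} → T (f u v) ⊎ m ⟨$⟩ʳ u ≡ v → Joined f bypass u v
    step (inj₁ uv) = EqC.return (inj₁ uv)
    step {u} (inj₂ refl) with u ≟ y
    ... | yes refl = y∼q
    ... | no u≢y with m ⟨$⟩ʳ u ≟ y
    ...   | no mu≢y  = EqC.return (inj₂ (bypass-other u≢y mu≢y))
    ...   | yes mu≡y = subst (Joined f bypass u) (sym mu≡y)
                         (EqC.return (inj₂ (bypass-before mu≡y)) ◅◅ eqClosure-sym y∼q)

module _ (m : Permutation′ n) {p} {P : U.Pred (Fin n) p} (P? : U.Decidable P)
         (invariant : ∀ {u v} → m ⟨$⟩ʳ u ≡ v → (P u → P v) × (P v → P u)) where

  private
    to from : Fin n → Fin n
    to   u = if does (P? u) then m ⟨$⟩ʳ u else u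
    from u = if does (P? u) then m ⟨$⟩ˡ u else u

    to-from : ∀ u → to (from u) ≡ u
    to-from u with P? u in eq
    ... | no _ rewrite eq = refl
    ... | yes Pu rewrite dec-true (P? (m ⟨$⟩ˡ u)) (proj₂ (invariant (Perm.inverseʳ m)) Pu) = Perm.inverseʳ m

    from-to : ∀ u → from (to u) ≡ u
    from-to u with P? u in eq
    ... | no _ rewrite eq = refl
    ... | yes Pu rewrite dec-true (P? (m ⟨$⟩ʳ u)) (proj₁ (invariant refl) Pu) = Perm.inverseˡ m

  restrict : Permutation′ n
  restrict = Perm.permutation to from to-from from-to

  restrict-in : ∀ {u} → P u → restrict ⟨$⟩ʳ u ≡ m ⟨$⟩ʳ u
  restrict-in {u} Pu rewrite dec-true (P? u) Pu = refl

  restrict-out : ∀ {u} → ¬ P u → restrict ⟨$⟩ʳ u ≡ u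
  restrict-out {u} ¬Pu rewrite dec-false (P? u) ¬Pu = refl

-- Along the orbit of x, whose members lie in pairwise different components of
-- f, the arcs u → σ u into the orbit are redirected to u → m (σ u).  This
-- merges the components, because a component of a regular digraph stays
-- connected when one arc is removed from it.
module Patch (f : Matrix n) (regular : Regular (suc e) f) (irreflexive : ∀ u → f u u ≡ false)
             (m : Permutation′ n) (x : Fin n)
             (distinct : ∀ {y z} → SameOrbit m y z → SameComponent f y z → y ≡ z) where

  infix 4 _∈O

  _∈O : Fin n → Set
  z ∈O = SameOrbit m x z

  ∈O? : U.Decidable _∈O
  ∈O? = sameOrbit? m x

  invariant : ∀ {u v} → m ⟨$⟩ʳ u ≡ v → (u ∈O → v ∈O) × (v ∈O → u ∈O)
  invariant uv = (_◅◅ EqC.return uv) , (_◅◅ eqClosure-sym (EqC.return uv))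

  invariant′ : ∀ {u v} → m ⟨$⟩ʳ u ≡ v → (¬ u ∈O → ¬ v ∈O) × (¬ v ∈O → ¬ u ∈O)
  invariant′ uv = let to , from = invariant uv in (_∘ from) , (_∘ to)

  orbit-part : Permutation′ n
  orbit-part = restrict m ∈O? invariant

  remainder : Permutation′ n
  remainder = restrict m (¬? ∘ ∈O?) invariant′

  σ : Permutation′ n
  σ = proj₁ (könig f regular)

  private
    σ⊆f : ∀ u → T (f u (σ ⟨$⟩ʳ u))
    σ⊆f = proj₂ (könig f regular)

  kept : Matrix n
  kept = delete f σ

  -- `orbit-part` fixes everything off the orbit of `x`, so `τ` differs from `σ` only on arcs into
  -- that orbit; being a permutation, it restores all degrees.
  τ : Permutation′ n
  τ = σ ∘ₚ orbit-part

  patched : Matrix n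
  patched = insert kept τ

  private
    loop-free : ∀ {u} → ¬ T (f u u)
    loop-free {u} uu = subst T (irreflexive u) uu

    ρ-in : ∀ {z} → z ∈O → orbit-part ⟨$⟩ʳ z ≡ m ⟨$⟩ʳ z
    ρ-in = restrict-in m ∈O? invariant

    ρ-out : ∀ {z} → ¬ z ∈O → orbit-part ⟨$⟩ʳ z ≡ z
    ρ-out = restrict-out m ∈O? invariant

    -- The arc of `σ` puts `u` in the component of `σ u`. The orbit meets that component only once,
    -- so the moved target lies elsewhere; hence a redirected arc is neither a loop nor already
    -- present.
    no-arc : ∀ u → σ ⟨$⟩ʳ u ∈O → m ⟨$⟩ʳ (σ ⟨$⟩ʳ u) ≢ σ ⟨$⟩ʳ u → ¬ SameComponent f u (m ⟨$⟩ʳ (σ ⟨$⟩ʳ u))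
    no-arc u z∈O moved u∼ = moved (sym (distinct (EqC.return refl)
      (eqClosure-sym (EqC.return (σ⊆f u)) ◅◅ u∼)))

    τ∌kept : ∀ u → ¬ T (kept u (τ ⟨$⟩ʳ u))
    τ∌kept u arc with ∈O? (σ ⟨$⟩ʳ u)
    ... | no _   = delete-∌ f σ arc
    ... | yes z∈O with m ⟨$⟩ʳ (σ ⟨$⟩ʳ u) ≟ σ ⟨$⟩ʳ u
    ...   | yes fixed = delete-∌ f σ (subst (T ∘ kept u) fixed arc)
    ...   | no moved  = no-arc u z∈O moved (EqC.return (delete-⊆ f σ arc))

    τ-irreflexive : ∀ u → τ ⟨$⟩ʳ u ≢ u
    τ-irreflexive u τu≡u with ∈O? (σ ⟨$⟩ʳ u)
    ... | no _   = loop-free (subst (T ∘ f u) τu≡u (σ⊆f u))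
    ... | yes z∈O with m ⟨$⟩ʳ (σ ⟨$⟩ʳ u) ≟ σ ⟨$⟩ʳ u
    ...   | yes fixed = loop-free (subst (T ∘ f u) (trans (sym fixed) τu≡u) (σ⊆f u))
    ...   | no moved  = no-arc u z∈O moved (≡⇒eqClosure (sym τu≡u))

  f-splits : Splits f kept σ
  f-splits = splits-delete f σ σ⊆f

  patched-splits : Splits patched kept τ
  patched-splits = splits-insert kept τ τ∌kept

  patched-regular : Regular (suc e) patched
  patched-regular = regular-insert patched-splits (regular-delete f-splits regular)

  patched-irreflexive : ∀ u → patched u u ≡ false
  patched-irreflexive u with patched u u in eq
  ... | false = refl
  ... | true with insert-cases kept τ {u} {u} (subst T (sym eq) tt)
  ...   | inj₁ uu   = contradiction (delete-⊆ f σ uu) loop-free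
  ...   | inj₂ τu≡u = contradiction τu≡u (τ-irreflexive u)

  remainder-support : m ⟨$⟩ʳ x ≢ x → support remainder ⊂ support m
  remainder-support x-moved = support-⊂ m remainder fix x-moved
    (restrict-out m (¬? ∘ ∈O?) invariant′ (λ x∉O → x∉O ε))
    where
    fix : ∀ {u} → m ⟨$⟩ʳ u ≡ u → remainder ⟨$⟩ʳ u ≡ u
    fix {u} mu≡u with ∈O? u
    ... | yes _ = refl
    ... | no _  = mu≡u

  private
    -- An arc lost from this component would be another `σ`-arc into the orbit. Its head would be a
    -- second orbit member in the component, so it equals `σ u`, and injectivity of `σ` gives
    -- `s ≡ u`.
    survives : ∀ {u} → σ ⟨$⟩ʳ u ∈O → ∀ {s v} → T (f s v) → s ≢ u →
               SameComponent f (σ ⟨$⟩ʳ u) s → T (patched s v)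
    survives {u} z∈O {s} {v} sv s≢u z∼s with σ ⟨$⟩ʳ s ≟ v
    ... | no σs≢v  = insert-⊇ kept τ (delete-∋ f σ sv σs≢v)
    ... | yes refl with ∈O? (σ ⟨$⟩ʳ s)
    ...   | no σs∉O = insert-∋ kept τ (ρ-out σs∉O)
    ...   | yes σs∈O = contradiction
      (permutation-injective σ (sym (distinct (eqClosure-sym z∈O ◅◅ σs∈O) (z∼s ◅◅ EqC.return sv)))) s≢u

    -- Regularity turns the arc from `u` to `σ u` into a directed path back from `σ u` to `u`. It
    -- can be stopped on reaching `u`, so it uses no arc leaving `u`, and all its arcs survive.
    redirected-arc : ∀ u → σ ⟨$⟩ʳ u ∈O → SameComponent patched (σ ⟨$⟩ʳ u) u
    redirected-arc u z∈O with star? (λ s v → T? (f s v) ×-dec ¬? (s ≟ u)) (σ ⟨$⟩ʳ u) u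
    ... | yes path = along ε ε path
      where
      along : ∀ {s t} → SameComponent f (σ ⟨$⟩ʳ u) s → SameComponent patched (σ ⟨$⟩ʳ u) s →
              Star (λ s v → T (f s v) × s ≢ u) s t → SameComponent patched (σ ⟨$⟩ʳ u) t
      along f∼ p∼ ε = p∼
      along f∼ p∼ ((sv , s≢u) ◅ path) =
        along (f∼ ◅◅ EqC.return sv) (p∼ ◅◅ EqC.return (survives z∈O sv s≢u f∼)) path
    ... | no ¬path = contradiction
      (closed-backwards regular (star? (λ s v → T? (f s v) ×-dec ¬? (s ≟ u)) (σ ⟨$⟩ʳ u))
        (λ sv z⇝s → z⇝s ◅◅ ((sv , λ { refl → ¬path z⇝s }) ◅ ε)) (σ⊆f u) ε)
      ¬path

  patched-joined : ∀ {u v} → Joined f m u v → Joined patched remainder u v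
  patched-joined = EqC.fold (EqC.isEquivalence _) step
    where
    step : ∀ {u v} → T (f u v) ⊎ m ⟨$⟩ʳ u ≡ v → Joined patched remainder u v
    step {u} {v} (inj₁ uv) with σ ⟨$⟩ʳ u ≟ v
    ... | no σu≢v  = EqC.return (inj₁ (insert-⊇ kept τ (delete-∋ f σ uv σu≢v)))
    ... | yes refl with ∈O? (σ ⟨$⟩ʳ u)
    ...   | no σu∉O  = EqC.return (inj₁ (insert-∋ kept τ (ρ-out σu∉O)))
    ...   | yes σu∈O = EqC.map inj₁ (eqClosure-sym (redirected-arc u σu∈O))
    step {z} (inj₂ refl) with ∈O? z
    ... | no z∉O  = EqC.return (inj₂ (restrict-in m (¬? ∘ ∈O?) invariant′ z∉O))
    -- With `u` the `σ`-predecessor of `z`: `z` is still joined to `u`, and the new arc leads from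
    -- `u` to `m z`.
    ... | yes z∈O = EqC.map inj₁
      (subst (λ v → SameComponent patched v (σ ⟨$⟩ˡ z)) σu≡z (redirected-arc _ (subst _∈O (sym σu≡z) z∈O))
       ◅◅ EqC.return (insert-∋ kept τ (trans (cong (orbit-part ⟨$⟩ʳ_) σu≡z) (ρ-in z∈O))))
      where
      σu≡z : σ ⟨$⟩ʳ (σ ⟨$⟩ˡ z) ≡ z
      σu≡z = Perm.inverseʳ σ

-- Costs of digraphs and permutations under reconnection

module Weights {a ℓ₁ ℓ₂} (K : OrderedField a ℓ₁ ℓ₂) where

  open OrderedField K hiding (sum; zero)
    renaming (refl to ≈-refl; sym to ≈-sym; trans to ≈-trans)
  open OrderedFieldProperties K
  open ≤-Reasoning

  record Cost (n : ℕ) : Set (a ⊔ ℓ₁ ⊔ ℓ₂) where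
    field
      c        : Fin n → Fin n → Carrier
      diagonal : ∀ u → c u u ≈ 0#
      nonNeg   : ∀ u v → 0# ≤ c u v
      triangle : ∀ u v z → c u z ≤ c u v + c v z

  module _ (C : Cost n) where
    open Cost C

    graphCost : Matrix n → Carrier
    graphCost f = sum λ u → sum λ v → if f u v then c u v else 0#

    permCost : Permutation′ n → Carrier
    permCost m = sum λ u → c u (m ⟨$⟩ʳ u)

    graphCost-splits : ∀ {f g σ} → Splits f g σ → graphCost f ≈ graphCost g + permCost σ
    graphCost-splits s = ≈-trans (sum-cong-≋ (λ u → sum-splits s u (c u))) (∑-distrib-+ _ (λ u → c u _))

    permCost-nonNeg : ∀ m → 0# ≤ permCost m
    permCost-nonNeg m = sum-nonNeg λ u → nonNeg u (m ⟨$⟩ʳ u)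

    -- Triangle inequality through `σ u`; reindexing by `σ` turns the second legs into the cost of
    -- `ρ`.
    permCost-∘-≤ : ∀ σ ρ → permCost (σ ∘ₚ ρ) ≤ permCost σ + permCost ρ
    permCost-∘-≤ σ ρ = begin
      permCost (σ ∘ₚ ρ)
        ≤⟨ ∑-mono-≤ (λ u → triangle u (σ ⟨$⟩ʳ u) _) ⟩
      sum (λ u → c u (σ ⟨$⟩ʳ u) + c (σ ⟨$⟩ʳ u) (ρ ⟨$⟩ʳ (σ ⟨$⟩ʳ u)))
        ≈⟨ ∑-distrib-+ (λ u → c u (σ ⟨$⟩ʳ u)) _ ⟩
      permCost σ + sum (λ u → c (σ ⟨$⟩ʳ u) (ρ ⟨$⟩ʳ (σ ⟨$⟩ʳ u)))
        ≈⟨ +-congˡ (sum-permute (λ u → c u (ρ ⟨$⟩ʳ u)) σ) ⟨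
      permCost σ + permCost ρ ∎

    -- The extra amount `k` is charged at `y` on the left and at the predecessor of `y` on the
    -- right. This makes the comparison termwise, with the triangle inequality used only at the
    -- predecessor.
    bypass-cost : ∀ m y y-moved → permCost (Bypass.bypass m y y-moved) ≤ permCost m
    bypass-cost m y y-moved = +-cancelʳ-≤ k (begin
      permCost bypass + k
        ≈⟨ +-congˡ (sum-δ y (λ _ → k)) ⟨
      permCost bypass + sum (λ u → at y u)
        ≈⟨ ∑-distrib-+ (λ u → c u (bypass ⟨$⟩ʳ u)) (at y) ⟨
      sum (λ u → c u (bypass ⟨$⟩ʳ u) + at y u)
        ≤⟨ ∑-mono-≤ pointwise ⟩
      sum (λ u → c u (m ⟨$⟩ʳ u) + at y (m ⟨$⟩ʳ u))
        ≈⟨ ∑-distrib-+ (λ u → c u (m ⟨$⟩ʳ u)) (at y ∘ (m ⟨$⟩ʳ_)) ⟩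
      permCost m + sum (λ u → at y (m ⟨$⟩ʳ u))
        ≈⟨ +-congˡ (≈-trans (≈-sym (sum-permute (at y) m)) (sum-δ y (λ _ → k))) ⟩
      permCost m + k ∎)
      where
      open Bypass m y y-moved
      q = m ⟨$⟩ʳ y
      k = c y q
      at : Fin n → Fin n → Carrier
      at y u = if does (y ≟ u) then k else 0#
      pointwise : ∀ u → c u (bypass ⟨$⟩ʳ u) + at y u ≤ c u (m ⟨$⟩ʳ u) + at y (m ⟨$⟩ʳ u)
      pointwise u with y ≟ u | y ≟ m ⟨$⟩ʳ u
      ... | yes refl | yes y≡q = contradiction (sym y≡q) y-moved
      ... | yes refl | no _    = begin
        c y (bypass ⟨$⟩ʳ y) + k ≈⟨ +-congʳ (reflexive (cong (c y) bypass-self)) ⟩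
        c y y + k               ≈⟨ +-congʳ (diagonal y) ⟩
        0# + k                  ≈⟨ +-comm 0# k ⟩
        k + 0#                  ∎
      ... | no _     | yes y≡mu = begin
        c u (bypass ⟨$⟩ʳ u) + 0# ≈⟨ +-identityʳ _ ⟩
        c u (bypass ⟨$⟩ʳ u)      ≈⟨ reflexive (cong (c u) (bypass-before (sym y≡mu))) ⟩
        c u q                    ≤⟨ triangle u y q ⟩
        c u y + k                ≈⟨ +-congʳ (reflexive (cong (c u) y≡mu)) ⟩
        c u (m ⟨$⟩ʳ u) + k       ∎
      ... | no y≢u   | no y≢mu = ≤-reflexive (+-congʳ (reflexive (cong (c u) (bypass-other (y≢u ∘ sym) (y≢mu ∘ sym)))))

    restrict-cost : ∀ m {p} {P : U.Pred (Fin n) p} (P? : U.Decidable P)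
                    (inv : ∀ {u v} → m ⟨$⟩ʳ u ≡ v → (P u → P v) × (P v → P u))
                    (inv′ : ∀ {u v} → m ⟨$⟩ʳ u ≡ v → (¬ P u → ¬ P v) × (¬ P v → ¬ P u)) →
                    permCost (restrict m P? inv) + permCost (restrict m (¬? ∘ P?) inv′) ≈ permCost m
    restrict-cost m P? inv inv′ = ≈-trans (≈-sym (∑-distrib-+ (λ u → c u (restrict m P? inv ⟨$⟩ʳ u)) _)) (sum-cong-≋ pointwise)
      where
      pointwise : ∀ u → c u (restrict m P? inv ⟨$⟩ʳ u) + c u (restrict m (¬? ∘ P?) inv′ ⟨$⟩ʳ u) ≈ c u (m ⟨$⟩ʳ u)
      pointwise u with P? u
      ... | yes _ = ≈-trans (+-congˡ (diagonal u)) (+-identityʳ _)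
      ... | no _  = ≈-trans (+-congʳ (diagonal u)) (+-identityˡ _)

    module _ (f : Matrix n) (regular : Regular (suc e) f) (irreflexive : ∀ u → f u u ≡ false)
             (m : Permutation′ n) (x : Fin n)
             (distinct : ∀ {y z} → SameOrbit m y z → SameComponent f y z → y ≡ z) where
      open Patch f regular irreflexive m x distinct

      orbit-split : permCost orbit-part + permCost remainder ≈ permCost m
      orbit-split = restrict-cost m ∈O? invariant invariant′

      -- Replacing `σ` by `τ` costs at most `permCost orbit-part`, which is exactly what `m` loses
      -- on shrinking to `remainder`.
      patched-cost : graphCost patched + permCost remainder ≤ graphCost f + permCost m
      patched-cost = begin
        graphCost patched + permCost remainder
          ≈⟨ +-congʳ (graphCost-splits patched-splits) ⟩
        (graphCost kept + permCost τ) + permCost remainder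
          ≤⟨ +-monoˡ-≤ _ (+-monoʳ-≤ _ (permCost-∘-≤ σ orbit-part)) ⟩
        (graphCost kept + (permCost σ + permCost orbit-part)) + permCost remainder
          ≈⟨ +-congʳ (+-assoc _ _ _) ⟨
        ((graphCost kept + permCost σ) + permCost orbit-part) + permCost remainder
          ≈⟨ +-assoc _ _ _ ⟩
        (graphCost kept + permCost σ) + (permCost orbit-part + permCost remainder)
          ≈⟨ +-cong (≈-sym (graphCost-splits f-splits)) orbit-split ⟩
        graphCost f + permCost m ∎

    record Reconnected (e : ℕ) (bound : Carrier) : Set (a ⊔ ℓ₁ ⊔ ℓ₂) where
      constructor reconnected
      field
        matrix      : Matrix n
        regular     : Regular e matrix
        irreflexive : ∀ u → matrix u u ≡ false
        connected   : ∀ u v → SameComponent matrix u v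
        cheap       : graphCost matrix ≤ bound

    weaken : ∀ {x y} → x ≤ y → Reconnected e x → Reconnected e y
    weaken x≤y (reconnected g r i conn cheap) = reconnected g r i conn (≤-trans cheap x≤y)

    -- Each round keeps `f` joined with `m` connected, does not raise `graphCost f + permCost m`,
    -- and shrinks the support of `m`. If two vertices of one orbit share a component, one of them
    -- is bypassed; otherwise the orbit of a moved vertex is patched in. The positive degree
    -- supplies the matching that `Patch` redirects.
    reconnect : ∀ m → Acc _⊂_ (support m) → ∀ f → Regular (suc e) f → (∀ u → f u u ≡ false) →
                (∀ u v → Joined f m u v) → Reconnected (suc e) (graphCost f + permCost m)
    reconnect m (acc rec) f regular irreflexive joined with any? (λ x → ¬? (m ⟨$⟩ʳ x ≟ x))
    ... | no m≗id = reconnected f regular irreflexive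
      (λ u v → EqC.fold (EqC.isEquivalence _) drop (joined u v)) (x≤x+y _ (permCost-nonNeg m))
      where
      drop : ∀ {u v} → T (f u v) ⊎ m ⟨$⟩ʳ u ≡ v → SameComponent f u v
      drop (inj₁ uv) = EqC.return uv
      drop {u} (inj₂ refl) with m ⟨$⟩ʳ u ≟ u
      ... | yes mu≡u = ≡⇒eqClosure (sym mu≡u)
      ... | no mu≢u  = contradiction (u , mu≢u) m≗id
    ... | yes (x , x-moved)
      with any? (λ y → any? (λ z → ¬? (z ≟ y) ×-dec sameOrbit? m y z ×-dec sameComponent? f y z))
    ...   | yes (y , z , z≢y , orbit , component) =
      weaken (+-monoʳ-≤ (graphCost f) (bypass-cost m y y-moved))
        (reconnect bypass (rec bypass-support) f regular irreflexive
          (λ u v → bypass-joined f z≢y orbit component (joined u v)))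
      where
      y-moved : m ⟨$⟩ʳ y ≢ y
      y-moved my≡y = z≢y (fixed-orbit refl orbit)
        where
        fixed-orbit : ∀ {s t} → s ≡ y → SameOrbit m s t → t ≡ y
        fixed-orbit s≡y  ε = s≡y
        fixed-orbit refl (fwd refl ◅ p) = fixed-orbit my≡y p
        fixed-orbit refl (bwd ms≡y ◅ p) = fixed-orbit (permutation-injective m (trans ms≡y (sym my≡y))) p
      open Bypass m y y-moved
    ...   | no none = weaken (patched-cost f regular irreflexive m x distinct)
        (reconnect remainder (rec (remainder-support x-moved)) patched patched-regular patched-irreflexive
          (λ u v → patched-joined (joined u v)))
      where
      distinct : ∀ {y z} → SameOrbit m y z → SameComponent f y z → y ≡ z
      distinct {y} {z} orbit component with z ≟ y
      ... | yes z≡y = sym z≡y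
      ... | no z≢y  = contradiction (y , z , z≢y , orbit , component) none
      open Patch f regular irreflexive m x distinct

-- Extremal graphs

full : Matrix n
full _ _ = true

sum-ones : ∀ n → ℕ∑.sum {n} (λ _ → 1) ≡ n
sum-ones zero    = refl
sum-ones (suc n) = cong suc (sum-ones n)

delete-irreflexive : ∀ (f : Matrix n) σ → (∀ u → f u u ≡ false) → ∀ u → delete f σ u u ≡ false
delete-irreflexive f σ irreflexive u with delete f σ u u in eq
... | false = refl
... | true  = contradiction (subst T (irreflexive u) (delete-⊆ f σ (subst T (sym eq) tt))) λ ()

-- Removing loops is deleting the identity permutation, so `regular-delete` gives the degrees.
offDiagonal : Matrix n → Matrix n
offDiagonal f = delete f Perm.id

offDiagonal-irreflexive : ∀ (f : Matrix n) u → offDiagonal f u u ≡ false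
offDiagonal-irreflexive f u with offDiagonal f u u in eq
... | false = refl
... | true  = contradiction (subst T (sym eq) tt) (delete-∌ f Perm.id {u})

offDiagonal-regular : ∀ (f : Matrix n) → (∀ u → T (f u u)) → Regular (suc e) f → Regular e (offDiagonal f)
offDiagonal-regular f loops = regular-delete (splits-delete f Perm.id loops)

complete : ∀ n → Subgraph n
complete n = record { arc = offDiagonal full ; loopless = offDiagonal-irreflexive full }

complete-factor : ∀ d → Factor d (complete (suc d))
complete-factor d = regular⇒factor {F = complete (suc d)}
  (offDiagonal-regular full (λ _ → tt) ((λ _ → sum-ones (suc d)) , (λ _ → sum-ones (suc d))))

complete-connected : Connected (complete n)
complete-connected u v with u ≟ v
... | yes refl = ε
... | no u≢v   = EqC.return (delete-∋ full Perm.id tt u≢v)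

Crosses : (Fin n → Bool) → Rel (Fin n) 0ℓ → Set
Crosses S R = ∃ λ u → ∃ λ v → R u v × T (S u) × ¬ T (S v)

-- If no arc left `S`, `S` would spread along arcs, and by `closed-backwards` also against them,
-- hence along the weak path from `s` to `t`.
regular-crosses : ∀ {f : Matrix n} → Regular e f → (∀ u v → SameComponent f u v) →
                  ∀ S {s t} → T (S s) → ¬ T (S t) → Crosses S (λ u v → T (f u v))
regular-crosses {f = f} regular connected S {s} {t} Ss ¬St
  with any? (λ u → any? (λ v → T? (f u v) ×-dec T? (S u) ×-dec ¬? (T? (S v))))
... | yes crossing = crossing
... | no none = contradiction (along (connected s t) Ss) ¬St
  where
  closed : ∀ {u v} → T (f u v) → T (S u) → T (S v)
  closed {u} {v} uv Su with T? (S v)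
  ... | yes Sv = Sv
  ... | no ¬Sv = contradiction (u , v , uv , Su , ¬Sv) none
  along : ∀ {u v} → SameComponent f u v → T (S u) → T (S v)
  along ε              Su = Su
  along (fwd uv ◅ path) Su = along path (closed uv Su)
  along (bwd vu ◅ path) Su = along path (closed-backwards {P = T ∘ S} regular (T? ∘ S) closed vu Su)

hamiltonian-crosses : ∀ {H : Subgraph n} → HamiltonianCycle H →
                      ∀ S {s t} → T (S s) → ¬ T (S t) → Crosses S (Arc H)
hamiltonian-crosses {H = H} (π , arcs) S {s} {t} Ss ¬St
  with any? (λ i → T? (S (π ⟨$⟩ʳ i)) ×-dec ¬? (T? (S (π ⟨$⟩ʳ next i))))
... | yes (i , Sπi , ¬Sπi′) = _ , _ , Equivalence.from (arcs _ _) (i , refl , refl) , Sπi , ¬Sπi′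
... | no none = contradiction
  (subst (T ∘ S) (Perm.inverseʳ π) (next-transitive (T ∘ S ∘ (π ⟨$⟩ʳ_)) step
    {π ⟨$⟩ˡ s} (subst (T ∘ S) (sym (Perm.inverseʳ π)) Ss) (π ⟨$⟩ˡ t))) ¬St
  where
  step : ∀ i → T (S (π ⟨$⟩ʳ i)) → T (S (π ⟨$⟩ʳ next i))
  step i Si with T? (S (π ⟨$⟩ʳ next i))
  ... | yes Si′ = Si′
  ... | no ¬Si′ = contradiction (i , Si , ¬Si′) none

module TwoCliques (N′ : ℕ) where

  private
    N = suc N′

  side : Fin (N ℕ.+ N) → Bool
  side = [ const true , const false ] ∘ splitAt N

  left right : Fin (N ℕ.+ N)
  left  = zero ↑ˡ N
  right = N ↑ʳ zero

  side-left : ∀ i → side (i ↑ˡ N) ≡ true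
  side-left i = cong [ _ , _ ] (splitAt-↑ˡ N i N)

  side-right : ∀ i → side (N ↑ʳ i) ≡ false
  side-right i = cong [ _ , _ ] (splitAt-↑ʳ N N i)

  agree : Bool → Bool → Bool
  agree true  b = b
  agree false b = not b

  agree-refl : ∀ b → T (agree b b)
  agree-refl true  = tt
  agree-refl false = tt

  agree-sym : ∀ b b′ → agree b b′ ≡ agree b′ b
  agree-sym true  true  = refl
  agree-sym true  false = refl
  agree-sym false true  = refl
  agree-sym false false = refl

  sameSide : Matrix (N ℕ.+ N)
  sameSide u v = agree (side u) (side v)

  private
    sum-++ : ∀ m {k} (f : Fin (m ℕ.+ k) → ℕ) → ℕ∑.sum f ≡ ℕ∑.sum (λ i → f (i ↑ˡ k)) ℕ.+ ℕ∑.sum (λ j → f (m ↑ʳ j))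
    sum-++ zero    f = refl
    sum-++ (suc m) f = trans (cong (f zero ℕ.+_) (sum-++ m (f ∘ suc))) (sym (ℕ.+-assoc (f zero) _ _))

    sum-side : ∀ b → ℕ∑.sum (λ v → χ (agree b (side v))) ≡ N
    sum-side b = trans (sum-++ N (λ v → χ (agree b (side v)))) (trans
      (cong₂ ℕ._+_ (ℕ∑.sum-cong-≗ (λ i → cong (χ ∘ agree b) (side-left i)))
                   (ℕ∑.sum-cong-≗ (λ i → cong (χ ∘ agree b) (side-right i))))
      (halves b))
      where
      halves : ∀ b → ℕ∑.sum {N} (λ _ → χ (agree b true)) ℕ.+ ℕ∑.sum {N} (λ _ → χ (agree b false)) ≡ N
      halves true  = trans (cong₂ ℕ._+_ (sum-ones N) (ℕ∑.sum-replicate-zero N)) (ℕ.+-identityʳ N)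
      halves false = cong₂ ℕ._+_ (ℕ∑.sum-replicate-zero N) (sum-ones N)

  sameSide-regular : Regular N sameSide
  sameSide-regular = (λ u → sum-side (side u)) ,
    (λ v → trans (ℕ∑.sum-cong-≗ (λ u → cong χ (agree-sym (side u) (side v)))) (sum-side (side v)))

  cliques : Matrix (N ℕ.+ N)
  cliques = offDiagonal sameSide

  cliques-regular : Regular N′ cliques
  cliques-regular = offDiagonal-regular sameSide (agree-refl ∘ side) sameSide-regular

  -- A 2-cycle through one vertex of each clique: in the form of a permutation it can be handed to
  -- `reconnect`.
  bridge : Permutation′ (N ℕ.+ N)
  bridge = transpose left right

  bridged : ∀ u v → Joined cliques bridge u v
  bridged u v = to-left u ◅◅ eqClosure-sym (to-left v)
    where
    same : ∀ u v → T (sameSide u v) → Joined cliques bridge u v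
    same u v uv with u ≟ v
    ... | yes refl = ε
    ... | no u≢v   = EqC.return (inj₁ (delete-∋ sameSide Perm.id uv u≢v))
    to-left : ∀ u → Joined cliques bridge u left
    to-left u with side u in eq
    ... | true  = same u left (subst₂ (λ b b′ → T (agree b b′)) (sym eq) (sym (side-left zero)) tt)
    ... | false = same u right (subst₂ (λ b b′ → T (agree b b′)) (sym eq) (sym (side-right zero)) tt)
                  ◅◅ EqC.return (inj₂ (transpose-right left right))

-- The inequalities between minimum weights

module _ {a ℓ₁ ℓ₂} (K : OrderedField a ℓ₁ ℓ₂) where

  open OrderedField K hiding (sum; zero)
    renaming (refl to ≈-refl; sym to ≈-sym; trans to ≈-trans)
  open OrderedFieldProperties K
  open Weights K
  open Comparison K
  open ≤-Reasoning

  -- The diagonal of an instance is unconstrained; with the value 0 the fixed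
  -- points of a permutation are free of charge.
  cost : Instance n → Cost n
  cost {n} G = record
    { c        = c
    ; diagonal = diagonal
    ; nonNeg   = λ u v → nonNeg′ u v
    ; triangle = triangle′
    }
    where
    open Instance G
    c : Fin n → Fin n → Carrier
    c u v = if does (u ≟ v) then 0# else w u v
    diagonal : ∀ u → c u u ≈ 0#
    diagonal u with u ≟ u
    ... | yes _  = ≈-refl
    ... | no u≢u = contradiction refl u≢u
    nonNeg′ : ∀ u v → 0# ≤ c u v
    nonNeg′ u v with u ≟ v
    ... | yes _  = ≤-refl
    ... | no u≢v = nonNeg u≢v
    triangle′ : ∀ u v z → c u z ≤ c u v + c v z
    triangle′ u v z with u ≟ v | v ≟ z | u ≟ z
    ... | yes refl | yes refl | yes _    = ≤-reflexive (≈-sym (+-identityˡ 0#))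
    ... | yes refl | yes refl | no u≢u   = contradiction refl u≢u
    ... | yes refl | no u≢z   | yes refl = contradiction refl u≢z
    ... | yes refl | no _     | no _     = ≤-reflexive (≈-sym (+-identityˡ _))
    ... | no u≢v   | yes refl | yes refl = contradiction refl u≢v
    ... | no _     | yes refl | no _     = ≤-reflexive (≈-sym (+-identityʳ _))
    ... | no u≢v   | no v≢z   | yes refl = ≤-trans (nonNeg u≢v) (x≤x+y _ (nonNeg v≢z))
    ... | no u≢v   | no v≢z   | no u≢z   = triangle u≢v v≢z u≢z

  -- The summands can differ only on the diagonal, where a loopless subgraph has no arc.
  weight≈graphCost : ∀ (G : Instance n) F → weight G F ≈ graphCost (cost G) (arc F)
  weight≈graphCost G F = sum-cong-≋ λ u → sum-cong-≋ λ v → summand u v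
    where
    open Instance G
    summand : ∀ u v → (if arc F u v then w u v else 0#) ≈ (if arc F u v then Cost.c (cost G) u v else 0#)
    summand u v with u ≟ v
    ... | no _     = ≈-refl
    ... | yes refl rewrite loopless F u = ≈-refl

  minimum-1* : ∀ {x y} → x ≤ y → x ≤ 1# * y
  minimum-1* x≤y = ≤-trans x≤y (≤-reflexive (≈-sym (*-identityˡ _)))

  factor≤connectedFactor : ∀ d → Valid d (Factor d) 1# (ConnectedFactor d)
  factor≤connectedFactor d _ G A B (_ , minA) ((factor , _) , _) = minimum-1* (minA B factor)

  fromReconnected : ∀ (G : Instance n) {bound} → Reconnected (cost G) e bound →
                    ∃ λ F → ConnectedFactor e F × weight G F ≤ bound
  fromReconnected {e = e} G (reconnected g regular irreflexive connected cheap) =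
    F , (regular⇒factor {F = F} regular , connected) , ≤-trans (≤-reflexive (weight≈graphCost G F)) cheap
    where
    F = record { arc = g ; loopless = irreflexive }

  -- The matching removed from `F` is itself the permutation along which the rest is rejoined, so
  -- the bound of `reconnect` is exactly the weight of `F`. Degree at least 2 leaves a positive
  -- degree after the removal.
  reduceDegree : ∀ (G : Instance n) F → ConnectedFactor (suc (suc e)) F →
                 ∃ λ F′ → ConnectedFactor (suc e) F′ × weight G F′ ≤ weight G F
  reduceDegree G F (factor , connected) =
    let regular = factor⇒regular {F = F} factor
        m , m⊆F = könig (arc F) regular
        s       = splits-delete (arc F) m m⊆F
        F′ , connectedFactor , cheap = fromReconnected G
          (reconnect (cost G) m (⊂-wellFounded _) (delete (arc F) m)
            (regular-delete s regular) (delete-irreflexive (arc F) m (loopless F))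
            (λ u v → EqC.map (split-arc m) (connected u v)))
    in F′ , connectedFactor , ≤-trans cheap (≤-reflexive
         (≈-trans (≈-sym (graphCost-splits (cost G) s)) (≈-sym (weight≈graphCost G F))))
    where
    split-arc : ∀ m {u v} → T (arc F u v) → T (delete (arc F) m u v) ⊎ m ⟨$⟩ʳ u ≡ v
    split-arc m {u} {v} uv with m ⟨$⟩ʳ u ≟ v
    ... | yes mu≡v = inj₂ mu≡v
    ... | no mu≢v  = inj₁ (delete-∋ (arc F) m uv mu≢v)

  connectedFactor-mono : ∀ e → Valid (suc (suc e)) (ConnectedFactor (suc e)) 1# (ConnectedFactor (suc (suc e)))
  connectedFactor-mono e _ G A B (_ , minA) (connectedFactor , _) =
    let F , connectedFactor′ , F≤B = reduceDegree G B connectedFactor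
    in minimum-1* (≤-trans (minA F connectedFactor′) F≤B)

  connectedFactor⇒hamiltonian : ∀ (G : Instance n) F → ConnectedFactor (suc e) F →
                                ∃ λ H → HamiltonianCycle H × weight G H ≤ weight G F
  connectedFactor⇒hamiltonian {e = zero} G F connectedFactor =
    F , connected-1-factor⇒hamiltonian {F = F} connectedFactor , ≤-refl
  connectedFactor⇒hamiltonian {e = suc e} G F connectedFactor =
    let F′ , connectedFactor′ , F′≤F = reduceDegree G F connectedFactor
        H , hamiltonian , H≤F′       = connectedFactor⇒hamiltonian G F′ connectedFactor′
    in H , hamiltonian , ≤-trans H≤F′ F′≤F

  hamiltonian≤connectedFactor : ∀ e → Valid (suc e) HamiltonianCycle 1# (ConnectedFactor (suc e))
  hamiltonian≤connectedFactor e _ G A B (_ , minA) (connectedFactor , _) =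
    let H , hamiltonian , H≤B = connectedFactor⇒hamiltonian G B connectedFactor
    in minimum-1* (≤-trans (minA H hamiltonian) H≤B)

  -- `g` loses one matching per induction step while `f` stays fixed, so the bound on permutations
  -- inside `f` remains available.
  graphCost-bound : ∀ (C : Cost n) (f : Matrix n) {β} →
                    (∀ σ → (∀ u → T (f u (σ ⟨$⟩ʳ u))) → permCost C σ ≤ β) →
                    ∀ e (g : Matrix n) → Regular e g → (∀ {u v} → T (g u v) → T (f u v)) → graphCost C g ≤ fromℕ e * β
  graphCost-bound C f {β} bound zero g (rows , _) _ = ≤-reflexive (≈-trans
    (sum-zero λ u → sum-zero λ v → empty u v) (≈-sym (zeroˡ β)))
    where
    empty : ∀ u v → (if g u v then Cost.c C u v else 0#) ≈ 0#
    empty u v with g u v in eq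
    ... | false = ≈-refl
    ... | true  = contradiction (subst T (sym eq) tt) (outRegular-0⇒empty {f = g} rows)
  graphCost-bound C f {β} bound (suc e) g regular g⊆f =
    let σ , σ⊆g = könig g regular
        s       = splits-delete g σ σ⊆g
    in begin
      graphCost C g
        ≈⟨ graphCost-splits C s ⟩
      graphCost C (delete g σ) + permCost C σ
        ≤⟨ +-mono-≤ (graphCost-bound C f bound e (delete g σ) (regular-delete s regular) (g⊆f ∘ delete-⊆ g σ))
                    (bound σ (λ u → g⊆f (σ⊆g u))) ⟩
      fromℕ e * β + β
        ≈⟨ +-comm _ _ ⟩
      β + fromℕ e * β
        ≈⟨ +-congʳ (*-identityˡ β) ⟨
      1# * β + fromℕ e * β
        ≈⟨ distribʳ β 1# (fromℕ e) ⟨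
      fromℕ (suc e) * β ∎

  -- Every 1-factor inside B weighs at most w(B) - w(A), as deleting it leaves
  -- a (d-1)-factor, and B is the union of d such 1-factors.
  factor-ratio : ∀ e → Valid (suc e) (Factor e) (fromℕ e / fromℕ (suc e)) (Factor (suc e))
  factor-ratio e _ G A B (_ , minA) (factor , _) = average e (begin
    weight G B                                    ≈⟨ weight≈graphCost G B ⟩
    graphCost C (arc B)                           ≤⟨ graphCost-bound C (arc B) permBound (suc e) (arc B) regular id ⟩
    fromℕ (suc e) * (weight G B - weight G A)     ∎)
    where
    C = cost G
    regular = factor⇒regular {F = B} factor
    permBound : ∀ σ → (∀ u → T (arc B u (σ ⟨$⟩ʳ u))) → permCost C σ ≤ weight G B - weight G A
    permBound σ σ⊆B = x+y≤z⇒x≤z-y (begin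
      permCost C σ + weight G A ≤⟨ +-monoʳ-≤ _ (minA F (regular⇒factor {F = F} (regular-delete s regular))) ⟩
      permCost C σ + weight G F ≈⟨ +-congˡ (weight≈graphCost G F) ⟩
      permCost C σ + graphCost C (arc F) ≈⟨ +-comm _ _ ⟩
      graphCost C (arc F) + permCost C σ ≈⟨ graphCost-splits C s ⟨
      graphCost C (arc B) ≈⟨ weight≈graphCost G B ⟨
      weight G B ∎)
      where
      F = record { arc = delete (arc B) σ ; loopless = delete-irreflexive (arc B) σ (loopless B) }
      s = splits-delete (arc B) σ σ⊆B

  -- Instances attaining the constants

  starInstance : ∀ n → Instance (suc n)
  starInstance n = record
    { w        = λ u v → at u
    ; nonNeg   = λ {u} _ → at-nonNeg u
    ; triangle = λ {u} {v} _ _ _ → x≤x+y _ (at-nonNeg v)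
    }
    where
    at : Fin (suc n) → Carrier
    at u = if does (zero ≟ u) then 1# else 0#
    at-nonNeg : ∀ u → 0# ≤ at u
    at-nonNeg zero    = 0≤1
    at-nonNeg (suc u) = ≤-refl

  star-weight : ∀ F → Factor e F → weight (starInstance n) F ≈ fromℕ e
  star-weight {e} {n} F factor = begin-equality
    weight (starInstance n) F
      ≈⟨ sum-cong-≋ row ⟩
    sum (λ u → if does (zero ≟ u) then outWeight u else 0#)
      ≈⟨ sum-δ zero outWeight ⟩
    outWeight zero
      ≈⟨ sum-indicator (arc F zero) (proj₁ (factor⇒regular {F = F} factor) zero) ⟩
    fromℕ e ∎
    where
    outWeight : Fin (suc n) → Carrier
    outWeight u = sum (λ v → if arc F u v then 1# else 0#)
    row : ∀ u → sum (λ v → if arc F u v then Instance.w (starInstance n) u v else 0#) ≈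
                (if does (zero ≟ u) then outWeight u else 0#)
    row zero    = ≈-refl
    row (suc u) = sum-zero λ v → vanish (arc F (suc u) v)
      where
      vanish : ∀ b → (if b then 0# else 0#) ≈ 0#
      vanish true  = ≈-refl
      vanish false = ≈-refl

  -- On `d + 1` vertices the complete digraph is a connected `d`-factor, and all `d`-factors of the
  -- star instance weigh the same, so it is a minimum in both classes.
  factor-tight : ∀ e → Tight (suc e) (Factor (suc e)) 1# (ConnectedFactor (suc e))
  factor-tight e η 0<η valid = no-slack
    (≤-reflexive (*-identityˡ _))
    (≤-trans (1≤fromℕ-suc e) (≤-reflexive (≈-sym (weightOf D factor))))
    0<η
    (valid ℕ.≤-refl G D D (factor , minimum) ((factor , complete-connected) , λ F cf → minimum F (proj₁ cf)))
    where
    G = starInstance (suc e)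
    D = complete (suc (suc e))
    factor : Factor (suc e) D
    factor = complete-factor (suc e)
    weightOf : ∀ F → Factor (suc e) F → weight G F ≈ fromℕ (suc e)
    weightOf F = star-weight F
    minimum : ∀ F → Factor (suc e) F → weight G D ≤ weight G F
    minimum F factorF = ≤-reflexive (≈-trans (weightOf D factor) (≈-sym (weightOf F factorF)))

  -- By `star-weight` factors of equal degree weigh the same, so any of them is a minimum. Deleting
  -- a matching from the complete digraph supplies the one of smaller degree.
  factor-ratio-tight : ∀ e → Tight (suc e) (Factor e) (fromℕ e / fromℕ (suc e)) (Factor (suc e))
  factor-ratio-tight e η 0<η valid = no-slack
    (begin
      (fromℕ e / fromℕ (suc e)) * weight G D ≈⟨ *-congˡ (star-weight D factor) ⟩
      (fromℕ e / fromℕ (suc e)) * fromℕ (suc e) ≈⟨ /-cancel e (fromℕ e) ⟩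
      fromℕ e ≈⟨ star-weight A factorA ⟨
      weight G A ∎)
    (≤-trans (1≤fromℕ-suc e) (≤-reflexive (≈-sym (star-weight D factor))))
    0<η
    (valid ℕ.≤-refl G A D (factorA , minimum A factorA) (factor , minimum D factor))
    where
    G = starInstance (suc e)
    D = complete (suc (suc e))
    factor : Factor (suc e) D
    factor = complete-factor (suc e)
    regular = factor⇒regular {F = D} factor
    σ = proj₁ (könig (arc D) regular)
    A : Subgraph (suc (suc e))
    A = record { arc = delete (arc D) σ ; loopless = delete-irreflexive (arc D) σ (loopless D) }
    factorA : Factor e A
    factorA = regular⇒factor {F = A}
      (regular-delete (splits-delete (arc D) σ (proj₂ (könig (arc D) regular))) regular)
    minimum : ∀ {k} F → Factor k F → ∀ F′ → Factor k F′ → weight G F ≤ weight G F′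
    minimum F factorF F′ factorF′ = ≤-reflexive (≈-trans (star-weight F factorF) (≈-sym (star-weight F′ factorF′)))

  -- A directed cut: the way back to the `true` side is free, so a 2-cycle across it costs no more
  -- than a single crossing.
  cut : Bool → Bool → Carrier
  cut true  false = 1#
  cut true  true  = 0#
  cut false _     = 0#

  cut-nonNeg : ∀ b b′ → 0# ≤ cut b b′
  cut-nonNeg true  true  = ≤-refl
  cut-nonNeg true  false = 0≤1
  cut-nonNeg false _     = ≤-refl

  cut-≤1 : ∀ b b′ → cut b b′ ≤ 1#
  cut-≤1 true  true  = 0≤1
  cut-≤1 true  false = ≤-refl
  cut-≤1 false _     = 0≤1

  cut-triangle : ∀ x y z → cut x z ≤ cut x y + cut y z
  cut-triangle true  true  false = ≤-reflexive (≈-sym (+-identityˡ 1#))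
  cut-triangle true  false false = ≤-reflexive (≈-sym (+-identityʳ 1#))
  cut-triangle true  y     true  = ≤-trans (cut-nonNeg true y) (x≤x+y _ (cut-nonNeg y true))
  cut-triangle false y     z     = ≤-trans (cut-nonNeg false y) (x≤x+y _ (cut-nonNeg y z))

  cutInstance : (Fin n → Bool) → Instance n
  cutInstance S = record
    { w        = λ u v → cut (S u) (S v)
    ; nonNeg   = λ {u} {v} _ → cut-nonNeg (S u) (S v)
    ; triangle = λ {u} {v} {z} _ _ _ → cut-triangle (S u) (S v) (S z)
    }

  crossing-weight : ∀ (S : Fin n → Bool) F → Crosses S (Arc F) → 1# ≤ weight (cutInstance S) F
  crossing-weight S F (u , v , uv , Su , ¬Sv) = begin
    1#                  ≈⟨ reflexive (arc-cost uv Su ¬Sv) ⟨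
    term u v            ≤⟨ summand≤sum v (nonNeg-term u) ⟩
    sum (term u)        ≤⟨ summand≤sum u (λ u → sum-nonNeg (nonNeg-term u)) ⟩
    weight (cutInstance S) F ∎
    where
    term : Fin _ → Fin _ → Carrier
    term u v = if arc F u v then cut (S u) (S v) else 0#
    arc-cost : ∀ {u v} → T (arc F u v) → T (S u) → ¬ T (S v) → term u v ≡ 1#
    arc-cost {u} {v} uv Su ¬Sv with arc F u v | S u | S v
    ... | true | true | false = refl
    ... | true | true | true  = contradiction tt ¬Sv
    nonNeg-term : ∀ u v → 0# ≤ term u v
    nonNeg-term u v with arc F u v
    ... | true  = cut-nonNeg (S u) (S v)
    ... | false = ≤-refl

  -- Connected factors of any degree and Hamiltonian cycles must leave `S`, hence weigh at least 1.
  -- This makes the light `B` optimal, and any such subgraph of weight at most 1 likewise.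
  record CutExample (d : ℕ) : Set (a ⊔ ℓ₁ ⊔ ℓ₂) where
    field
      {size}          : ℕ
      d<size          : d ℕ.< size
      S               : Fin size → Bool
      s t             : Fin size
      s∈S             : T (S s)
      t∉S             : ¬ T (S t)
      B               : Subgraph size
      connectedFactor : ConnectedFactor d B
      light           : weight (cutInstance S) B ≤ 1#

    G : Instance size
    G = cutInstance S

    connectedFactor-≥1 : ∀ {k} F → ConnectedFactor k F → 1# ≤ weight G F
    connectedFactor-≥1 F (factor , connected) = crossing-weight S F
      (regular-crosses (factor⇒regular {F = F} factor) connected S s∈S t∉S)

    hamiltonian-≥1 : ∀ H → HamiltonianCycle H → 1# ≤ weight G H
    hamiltonian-≥1 H hamiltonian = crossing-weight S H (hamiltonian-crosses {H = H} hamiltonian S s∈S t∉S)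

    B-minimum : MinimumWeight (ConnectedFactor d) G B
    B-minimum = connectedFactor , λ F cf → ≤-trans light (connectedFactor-≥1 F cf)

    tight : ∀ (P : SubgraphProperty) {η} (A : Subgraph size) → 1# ≤ weight G A → 0# < η →
            MinimumWeight P G A → ¬ Valid d P (1# - η) (ConnectedFactor d)
    tight P A 1≤A 0<η minA valid = no-slack
      (≤-trans (≤-reflexive (*-identityˡ _)) (≤-trans light 1≤A))
      (connectedFactor-≥1 B connectedFactor) 0<η
      (valid d<size G A B minA B-minimum)

  cutExample : ∀ e → CutExample (suc e)
  cutExample e = record
    -- There are `2 (d + 1)` vertices with `d = e + 1`, so that each clique has degree `d`.
    { d<size          = ℕ.m≤m+n (suc (suc e)) (suc (suc e))
    ; S               = side
    ; s               = left
    ; t               = right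
    ; s∈S             = subst T (sym (side-left zero)) tt
    ; t∉S             = subst T (side-right zero)
    ; B               = proj₁ example
    ; connectedFactor = proj₁ (proj₂ example)
    ; light           = proj₂ (proj₂ example)
    }
    where
    open TwoCliques (suc e)
    G = cutInstance side
    C = cost G
    open Cost C
    no-cost : ∀ u v → T (sameSide u v) → c u v ≈ 0#
    no-cost u v uv with u ≟ v | side u | side v
    ... | yes _ | _     | _     = ≈-refl
    ... | no _  | true  | true  = ≈-refl
    ... | no _  | false | false = ≈-refl
    from-right : ∀ {u v} → side u ≡ false → c u v ≈ 0#
    from-right {u} {v} eq with u ≟ v
    ... | yes _ = ≈-refl
    ... | no _ rewrite eq = ≈-refl
    c-≤1 : ∀ u v → c u v ≤ 1#
    c-≤1 u v with u ≟ v
    ... | yes _ = 0≤1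
    ... | no _  = cut-≤1 (side u) (side v)
    free : graphCost C cliques ≈ 0#
    free = sum-zero λ u → sum-zero λ v → summand u v
      where
      summand : ∀ u v → (if cliques u v then c u v else 0#) ≈ 0#
      summand u v with cliques u v in eq
      ... | false = ≈-refl
      ... | true  = no-cost u v (delete-⊆ sameSide Perm.id (subst T (sym eq) tt))
    bridge-cost : permCost C bridge ≤ 1#
    bridge-cost = begin
      permCost C bridge                                  ≤⟨ ∑-mono-≤ pointwise ⟩
      sum (λ u → if does (left ≟ u) then 1# else 0#)     ≈⟨ sum-δ left (λ _ → 1#) ⟩
      1#                                                 ∎
      where
      -- Only the arc leaving `left` can be charged: `right` lies on the `false` side, and every
      -- other vertex is fixed.
      pointwise : ∀ u → c u (bridge ⟨$⟩ʳ u) ≤ (if does (left ≟ u) then 1# else 0#)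
      pointwise u with left ≟ u
      ... | yes _ = c-≤1 u _
      ... | no left≢u with u ≟ right
      ...   | yes refl = ≤-reflexive (from-right {u} {bridge ⟨$⟩ʳ u} (side-right zero))
      ...   | no u≢right = ≤-reflexive (≈-trans
                (reflexive (cong (c u) (transpose-fixes left right u (left≢u ∘ sym) u≢right))) (diagonal u))
    example : ∃ λ B → ConnectedFactor (suc e) B × weight G B ≤ 1#
    example = fromReconnected G (weaken C
      (≤-trans (+-mono-≤ (≤-reflexive free) bridge-cost) (≤-reflexive (+-identityˡ 1#)))
      (reconnect C bridge (⊂-wellFounded _) cliques cliques-regular (offDiagonal-irreflexive sameSide) bridged))

  -- The optimal cycle comes from the upper bound itself: applied to `B` it yields a cycle of weight
  -- at most 1, and no cycle is lighter than 1.
  hamiltonian-tight : ∀ e → Tight (suc e) HamiltonianCycle 1# (ConnectedFactor (suc e))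
  hamiltonian-tight e η 0<η =
    let H , hamiltonian , H≤B = connectedFactor⇒hamiltonian G B connectedFactor
    in tight HamiltonianCycle H (hamiltonian-≥1 H hamiltonian) 0<η
         (hamiltonian , λ H′ hamiltonian′ → ≤-trans H≤B (≤-trans light (hamiltonian-≥1 H′ hamiltonian′)))
    where open CutExample (cutExample e)

  connectedFactor-mono-tight : ∀ e → Tight (suc (suc e)) (ConnectedFactor (suc e)) 1# (ConnectedFactor (suc (suc e)))
  connectedFactor-mono-tight e η 0<η =
    let F , connectedFactor′ , F≤B = reduceDegree G B connectedFactor
    in tight (ConnectedFactor (suc e)) F (connectedFactor-≥1 F connectedFactor′) 0<η
         (connectedFactor′ , λ F′ cf′ → ≤-trans F≤B (≤-trans light (connectedFactor-≥1 F′ cf′)))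
    where open CutExample (cutExample (suc e))

lemma2p2 : ∀ {a ℓ₁ ℓ₂} (K : OrderedField a ℓ₁ ℓ₂) →
    let open OrderedField K
        open Comparison K
    in
    (∀ d → 1 ℕ.≤ d → ValidAndTight d (Factor d) 1# (ConnectedFactor d)) ×
    (∀ d → 1 ℕ.≤ d → ValidAndTight d HamiltonianCycle 1# (ConnectedFactor d)) ×
    (∀ d → 2 ℕ.≤ d →
      ValidAndTight d (Factor (d ∸ 1)) (fromℕ (d ∸ 1) / fromℕ d) (Factor d) ×
      ValidAndTight d (ConnectedFactor (d ∸ 1)) 1# (ConnectedFactor d))
lemma2p2 K =
  (λ { (suc e) _ → factor≤connectedFactor K (suc e) , factor-tight K e }) ,
  (λ { (suc e) _ → hamiltonian≤connectedFactor K e , hamiltonian-tight K e }) ,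
  (λ { (suc (suc e)) _ →
         (factor-ratio K (suc e) , factor-ratio-tight K (suc e)) ,
         (connectedFactor-mono K e , connectedFactor-mono-tight K e)
     ; (suc zero) (s≤s ()) })
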